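{- Let $\pi$ be a derivation of $\Lambda\vdash t:L$, where $\Lambda$ is a ground context and $L$ a ground type, and let $\psi$ be the factor inductively assigned to $\pi$ by the decoration rules. Then $[\![\pi]\!]=\psi$.
   Context: **Terms.** Terms $t,u$ and values $v,w$ (up to $\alpha$-equivalence): $t,u ::= v \mid \mathsf{sample}_d \mid \mathsf{case}\ v\ \mathsf{of}\ \{v_i\Rightarrow \mathsf{sample}_{d_i}\} \mid \mathsf{obs}(x=b) \mid \mathsf{let}\ x=u\ \mathsf{in}\ t \mid \mathsf{letp}\ \langle x,y\rangle=v\ \mathsf{in}\ t \mid t\,v\mid \lambda x.t\mid \mathsf{der}\,v$; $v,w ::= x \mid \langle v,w\rangle \mid\ !t \mid b$; $b::=\mathtt t\mid\mathtt f$; $d$ ranges over probability distributions on $\{\mathtt t,\mathtt f\}$. $\mathsf c\langle y_1,\dots,y_n\rangle$ abbreviates $\mathsf{case}\ \langle y_1,\dots,y_n\rangle\ \mathsf{of}\ \{\bar b\Rightarrow\mathsf{sample}_{d_{\bar b}}\}_{\bar b\in\{\mathtt t,\mathtt f\}^n}$. **Intersection types.** Fix a countable set of names $X,Y,Z,\dots$. Ground types $K,L::=X\mid K\otimes L$; positive types $P,Q::=L\mid[A_1,\dots,A_n]$ (finite multiset, $n\ge0$); types $A,B::=P\mid P\multimap A$. A typing context is a total map from variables to positive types with all but finitely many variables mapped to $[]$; it splits into its ground part $\Lambda$ (variables mapped to ground types) and its multiset part $\Gamma$; $\uplus$ is (pointwise) multiset union. $\mathrm{Nm}(\cdot)$ is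 the set of names occurring. Rules (premises $\Longrightarrow$ conclusion): - (i-sample) $\Lambda\vdash\mathsf{sample}_d:X$ if $X\notin\mathrm{Nm}(\Lambda)$. - (i-cond) $\Lambda,y_1:Y_1,\dots,y_n:Y_n\vdash\mathsf c\langle y_1,\dots,y_n\rangle:X$ if $X\notin\{Y_1,\dots,Y_n\}$ and $X\notin\mathrm{Nm}(\Lambda)$. - (i-var) $\Lambda,x:P\vdash x:P$. - (i-let) $\Lambda,\Gamma_1\vdash u:P$ and $\Lambda,\Gamma_2,x:P\vdash t:A$ $\Longrightarrow$ $\Lambda,\Gamma_1\uplus\Gamma_2\vdash\mathsf{let}\ x=u\ \mathsf{in}\ t:A$. - (i-pair) $\Lambda\vdash v:L_1$ and $\Lambda\vdash w:L_2$ $\Longrightarrow$ $\Lambda\vdash\langle v,w\rangle:L_1\otimes L_2$. - (i-letp) $\Lambda\vdash v:L_1\otimes L_2$ and $\Lambda,x:L_1,y:L_2,\Gamma\vdash t:A$ $\Longrightarrow$ $\Lambda,\Gamma\vdash\mathsf{letp}\ \langle x,y\rangle=v\ \mathsf{in}\ t:A$. - (i-abs) $\Lambda,\Gamma,x:P\vdash t:A$ $\Longrightarrow$ $\Lambda,\Gamma\vdash\lambda x.t:P\multimap A$. - (i-app) $\Lambda,\Gamma_1\vdash t:P\multimap A$ and $\Lambda,\Gamma_2\vdash v:P$ $\Longrightarrow$ $\Lambda,\Gamma_1\uplus\Gamma_2\vdash t\,v:A$. - (i-bang) $(\Lambda,\Gamma_i\vdash t:A_i)_{i=1}^n$, $n\ge0$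 $\Longrightarrow$ $\Lambda,\biguplus_i\Gamma_i\vdash\,!t:[A_1,\dots,A_n]$. - (i-der) $\Lambda,\Gamma\vdash v:[A]$ $\Longrightarrow$ $\Lambda,\Gamma\vdash\mathsf{der}\,v:A$. Axioms (i-sample), (i-cond) are the *probabilistic axioms*; the name $X$ typing the subject is their *main name*. Naming condition (part of the definition of a derivation): main names are pairwise distinct. **Factors.** $\mathrm{Val}(X)=\{\mathtt t,\mathtt f\}$ for each name; for a finite set of names $\mathbb X$, $\mathrm{Val}(\mathbb X)=\prod_{X\in\mathbb X}\mathrm{Val}(X)$, and $\bar x|_{\mathbb Y}$ is restriction to $\mathbb Y\subseteq\mathbb X$. A factor over $\mathbb X$ is a function $\phi:\mathrm{Val}(\mathbb X)\to\mathbb R_{\ge0}$; $\mathrm{Nm}(\phi)=\mathbb X$. Sum out: for $\mathbb Z\subseteq\mathbb X$, $\sum_{\mathbb Z}\phi$ is the factor over $\mathbb X-\mathbb Z$ with $(\sum_{\mathbb Z}\phi)(\bar y)=\sum_{\bar z\in\mathrm{Val}(\mathbb Z)}\phi(\bar z\bar y)$. Product: $(\phi_1\odot\phi_2)(\bar z)=\phi_1(\bar z|_{\mathrm{Nm}(\phi_1)})\,\phi_2(\bar z|_{\mathrm{Nm}(\phi_2)})$, a factor over $\mathrm{Nm}(\phi_1)\cup\mathrm{Nm}(\phi_2)$; $\mathbf 1_\emptyset$ is the factor over $\emptyset$ with value $1$ (the empty product). **Semantics of a derivation.** To $\Lambda\vdash\mathsf{sample}_d:X$ is associated the factor over $\{X\}$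 with $\phi(x)=d(x)$; to an (i-cond) axiom $\Lambda,y_1:Y_1,\dots,y_n:Y_n\vdash\mathsf{case}\ \langle y_1,\dots,y_n\rangle\ \mathsf{of}\ \{\bar b\Rightarrow\mathsf{sample}_{d_{\bar b}}\}_{\bar b\in\{\mathtt t,\mathtt f\}^n}:X$ is associated the factor over $\mathbb Y\cup\{X\}$, $\mathbb Y=\{Y_1,\dots,Y_n\}$, with $\phi(\bar y\,x)=d_{\langle\bar y|_{Y_1},\dots,\bar y|_{Y_n}\rangle}(x)$. For a derivation $\pi$ of a judgment $J$, let $\mathrm{Cpts}(\pi)$ be the family of factors associated with its probabilistic axioms and $\mathbb X=\bigcup_{\phi\in\mathrm{Cpts}(\pi)}\mathrm{Nm}(\phi)$; then $[\![\pi]\!]=\sum_{\mathbb X-\mathrm{Nm}(J)}\big(\bigodot_{\phi\in\mathrm{Cpts}(\pi)}\phi\big)$. **Inductive decoration.** A factor is assigned to each (sub)derivation by induction: a probabilistic axiom gets its associated factor; (i-var) gets $\mathbf 1_\emptyset$; (i-pair) gets $\mathbf 1_\emptyset$ (its premises having $\mathbf 1_\emptyset$); (i-letp) gets the factor of the premise typing $t$ (the other premise having $\mathbf 1_\emptyset$); (i-abs) and (i-der) get the factor of their premise; (i-bang) gets $\bigodot_i\psi_i$, with $\psi_i$ the factors of its premises; (i-let) and (i-app), with premises having factors $\psi_1,\psi_2$ over $\mathbb Y_1,\mathbb Y_2$, get $\sum_{\mathbb Z}(\psi_1\odot\psi_2)$ with $\mathbb Z=(\mathbb Y_1\cup\mathbb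 Y_2)-\mathrm{Nm}(\Lambda,\Gamma_1,\Gamma_2,A)$. -}

module Defs where

open import Algebra.Bundles using (CommutativeSemiring)
open import Data.Bool.Base using (Bool; true; false)
open import Data.Fin.Base using (Fin; zero; suc)
open import Data.List.Base as List using (List; []; _∷_; [_]; _++_; concatMap; deduplicate; filter; foldr)
open import Data.List.Membership.Propositional using (_∈_; _∉_)
open import Data.List.Membership.Propositional.Properties
  using (∈-++⁺ˡ; ∈-++⁺ʳ; ∈-deduplicate⁺; ∈-filter⁺; ∈-filter⁻)
open import Data.List.Relation.Binary.Permutation.Homogeneous using (Permutation)
open import Data.List.Relation.Binary.Subset.Propositional using (_⊆_)
open import Data.List.Relation.Unary.All as All using (All; []; _∷_)
open import Data.List.Relation.Unary.Any using (here)
open import Data.List.Relation.Unary.Unique.Propositional using (Unique)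
open import Data.List.Relation.Unary.Unique.Propositional.Properties using (filter⁺)
open import Data.Nat.Base using (ℕ; zero; suc)
open import Data.Nat.Properties using (_≟_)
open import Data.Product.Base using (_×_; _,_; proj₁)
open import Data.Vec.Base as Vec using (Vec; []; _∷_; lookup)
open import Data.Vec.Membership.Propositional.Properties using (∈-lookup; ∈-toList⁺)
open import Level using (Level; _⊔_)
open import Relation.Binary.PropositionalEquality.Core using (_≡_; _≢_; refl)
open import Relation.Nullary.Decidable.Core using (¬?; yes; no)

open import Data.List.Membership.DecPropositional _≟_ using (_∈?_)
open import Data.List.Relation.Unary.Unique.DecPropositional.Properties _≟_ using (deduplicate-!)

------------------------------------------------------------------------
-- Names and finite sets of names

Name : Set
Name = ℕ

-- The order of the list is irrelevant: sets of names are only ever compared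
-- by mutual inclusion.
record NameSet : Set where
  constructor mkNameSet
  field
    elems  : List Name
    unique : Unique elems

open NameSet public

fromList : List Name → NameSet
fromList Xs = mkNameSet (deduplicate _≟_ Xs) (deduplicate-! Xs)

infixl 6 _∪_ _∖_

_∪_ : NameSet → NameSet → NameSet
𝕏 ∪ 𝕐 = fromList (elems 𝕏 ++ elems 𝕐)

_∖_ : NameSet → NameSet → NameSet
𝕏 ∖ 𝕐 = mkNameSet
  (filter (λ X → ¬? (X ∈? elems 𝕐)) (elems 𝕏))
  (filter⁺ (λ X → ¬? (X ∈? elems 𝕐)) (unique 𝕏))

∅ : NameSet
∅ = fromList []

⁅_⁆ : Name → NameSet
⁅ X ⁆ = fromList [ X ]

⊆-∪ˡ : ∀ 𝕏 𝕐 → elems 𝕏 ⊆ elems (𝕏 ∪ 𝕐)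
⊆-∪ˡ 𝕏 𝕐 p = ∈-deduplicate⁺ _≟_ (∈-++⁺ˡ p)

⊆-∪ʳ : ∀ 𝕏 𝕐 → elems 𝕐 ⊆ elems (𝕏 ∪ 𝕐)
⊆-∪ʳ 𝕏 𝕐 p = ∈-deduplicate⁺ _≟_ (∈-++⁺ʳ (elems 𝕏) p)

∖-⊆ : ∀ 𝕏 𝕐 → elems (𝕏 ∖ 𝕐) ⊆ elems 𝕏
∖-⊆ 𝕏 𝕐 p = proj₁ (∈-filter⁻ (λ X → ¬? (X ∈? elems 𝕐)) {xs = elems 𝕏} p)

------------------------------------------------------------------------
-- Intersection types

infixr 7 _⊗_
infixr 6 _⊸_

data Ground : Set where
  name : Name → Ground
  _⊗_  : Ground → Ground → Ground

-- A finite multiset [A₁,…,Aₙ] is represented by a list `bag (A₁ ∷ … ∷ Aₙ ∷ [])`;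
-- the identification of lists up to (hereditary) permutation is _≅_ below.
data Pos : Set
data Ty  : Set

data Pos where
  gnd : Ground → Pos
  bag : List Ty → Pos

data Ty where
  pos : Pos → Ty
  _⊸_ : Pos → Ty → Ty

infix 4 _≅ᵖ_ _≅_

data _≅ᵖ_ : Pos → Pos → Set
data _≅_  : Ty → Ty → Set

data _≅ᵖ_ where
  gnd : ∀ {L} → gnd L ≅ᵖ gnd L
  bag : ∀ {As Bs} → Permutation _≅_ As Bs → bag As ≅ᵖ bag Bs

data _≅_ where
  pos : ∀ {P Q} → P ≅ᵖ Q → pos P ≅ pos Q
  _⊸_ : ∀ {P Q A B} → P ≅ᵖ Q → A ≅ B → P ⊸ A ≅ Q ⊸ B

nmᵍ : Ground → List Name
nmᵍ (name X) = [ X ]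
nmᵍ (K ⊗ L)  = nmᵍ K ++ nmᵍ L

mutual
  nmᵖ : Pos → List Name
  nmᵖ (gnd L)  = nmᵍ L
  nmᵖ (bag As) = nm* As

  nmᵗ : Ty → List Name
  nmᵗ (pos P) = nmᵖ P
  nmᵗ (P ⊸ A) = nmᵖ P ++ nmᵗ A

  nm* : List Ty → List Name
  nm* []       = []
  nm* (A ∷ As) = nmᵗ A ++ nm* As

------------------------------------------------------------------------
-- Typing contexts
--
-- Variables are de Bruijn indices. A context assigns a positive type to each
-- of the n variables in scope (all others being implicitly mapped to []). Its
-- ground part Λ consists of the entries `gnd L`, its multiset part Γ of the
-- entries `bag As`.

Ctx : ℕ → Set
Ctx n = Vec Pos n

nmᶜ : ∀ {n} → Ctx n → List Name
nmᶜ Θ = concatMap nmᵖ (Vec.toList Θ)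

-- Nm(J) for a judgment J = Θ ⊢ t : A
nmᴶ : ∀ {n} → Ctx n → Ty → NameSet
nmᴶ Θ A = fromList (nmᶜ Θ ++ nmᵗ A)

data GroundEntry : Pos → Set where
  gnd   : ∀ {L} → GroundEntry (gnd L)
  empty : GroundEntry (bag [])

-- Θ is of the form Λ: no variable is mapped to a nonempty multiset.
GroundCtx : ∀ {n} → Ctx n → Set
GroundCtx Θ = ∀ x → GroundEntry (lookup Θ x)

groundPart : ∀ {n} → Ctx n → Ctx n
groundPart = Vec.map λ where
  (gnd L) → gnd L
  (bag _) → bag []

infix 4 _≡_⊎ᵖ_ _≡_⊎_ _≅ᶜ_

data _≡_⊎ᵖ_ : Pos → Pos → Pos → Set where
  gnd : ∀ {L} → gnd L ≡ gnd L ⊎ᵖ gnd L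
  bag : ∀ {As Bs} → bag (As ++ Bs) ≡ bag As ⊎ᵖ bag Bs

-- Θ = Λ,Γ₁⊎Γ₂ where Θ₁ = Λ,Γ₁ and Θ₂ = Λ,Γ₂ (with the same Λ).
_≡_⊎_ : ∀ {n} → Ctx n → Ctx n → Ctx n → Set
Θ ≡ Θ₁ ⊎ Θ₂ = ∀ x → lookup Θ x ≡ lookup Θ₁ x ⊎ᵖ lookup Θ₂ x

_≅ᶜ_ : ∀ {n} → Ctx n → Ctx n → Set
Θ ≅ᶜ Θ′ = ∀ x → lookup Θ x ≅ᵖ lookup Θ′ x

------------------------------------------------------------------------
-- Valuations, for Val(X) = {t,f} = Bool

Val : NameSet → Set
Val 𝕏 = All (λ _ → Bool) (elems 𝕏)

restrict : ∀ 𝕏 𝕐 → elems 𝕐 ⊆ elems 𝕏 → Val 𝕏 → Val 𝕐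
restrict _ _ 𝕐⊆𝕏 x̄ = All.tabulate (λ p → All.lookup x̄ (𝕐⊆𝕏 p))

glue : ∀ 𝕏 ℤ → Val ℤ → Val (𝕏 ∖ ℤ) → Val 𝕏
glue 𝕏 ℤ z̄ ȳ = All.tabulate value
  where
  value : ∀ {X} → X ∈ elems 𝕏 → Bool
  value {X} p with X ∈? elems ℤ
  ... | yes X∈ℤ = All.lookup z̄ X∈ℤ
  ... | no  X∉ℤ = All.lookup ȳ (∈-filter⁺ (λ Y → ¬? (Y ∈? elems ℤ)) p X∉ℤ)

------------------------------------------------------------------------
-- The scalars: only the commutative semiring structure of ℝ≥0 is involved,
-- so an arbitrary commutative semiring R takes its place.

module Calculus {c ℓ : Level} (R : CommutativeSemiring c ℓ) where

  open CommutativeSemiring R using (Carrier; _≈_; _+_; _*_; 1#)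

  -- A probability distribution on {t,f}; for R = ℝ≥0 nonnegativity is built
  -- into the carrier.
  record Dist : Set (c ⊔ ℓ) where
    field
      prob  : Bool → Carrier
      total : prob true + prob false ≈ 1#

  open Dist public

  ----------------------------------------------------------------------
  -- Terms and values with n free variables, up to α-equivalence.

  data Value (n : ℕ) : Set (c ⊔ ℓ)
  data Term  (n : ℕ) : Set (c ⊔ ℓ)

  data Value n where
    var   : Fin n → Value n
    ⟨_,_⟩ : Value n → Value n → Value n
    !_    : Term n → Value n
    bool  : Bool → Value n

  -- In `letp v t`, for letp ⟨x,y⟩ = v in t, the variable x is index 1 and y is
  -- index 0 of t.
  data Term n where
    val    : Value n → Term n
    sample : Dist → Term n
    case   : Value n → List (Value n × Dist) → Term n
    obs    : Fin n → Bool → Term n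
    let′   : Term n → Term (suc n) → Term n
    letp   : Value n → Term (suc (suc n)) → Term n
    _·_    : Term n → Value n → Term n
    lam    : Term (suc n) → Term n
    der    : Value n → Term n

  -- ⟨v₁,…,vₖ⟩ for k ≥ 1, as right-nested pairs; ⟨v⟩ is v itself.
  tuple : ∀ {n k} → Vec (Value n) (suc k) → Value n
  tuple (v ∷ [])     = v
  tuple (v ∷ w ∷ vs) = ⟨ v , tuple (w ∷ vs) ⟩

  allBools : ∀ k → List (Vec Bool k)
  allBools zero    = [ [] ]
  allBools (suc k) =
    List.map (true ∷_) (allBools k) ++ List.map (false ∷_) (allBools k)

  -- 𝖼⟨y₁,…,yₖ⟩ = case ⟨y₁,…,yₖ⟩ of {b̄ ⇒ sample (d b̄)}, b̄ ∈ {t,f}ᵏ, for k ≥ 1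
  cond : ∀ {n k} → Vec (Fin n) (suc k) → (Vec Bool (suc k) → Dist) → Term n
  cond ys d = case (tuple (Vec.map var ys))
    (List.map (λ b̄ → tuple (Vec.map bool b̄) , d b̄) (allBools _))

  ----------------------------------------------------------------------
  -- Derivation trees

  infix 3 _⊢_∶_ _⊢!_∶_

  data _⊢_∶_  {n : ℕ} : Ctx n → Term n → Ty → Set (c ⊔ ℓ)
  data _⊢!_∶_ {n : ℕ} : Ctx n → Term n → List Ty → Set (c ⊔ ℓ)

  data _⊢_∶_ {n} where

    i-sample : ∀ {Λ d} X →
      GroundCtx Λ → X ∉ nmᶜ Λ →
      Λ ⊢ sample d ∶ pos (gnd (name X))

    -- Λ is the whole context, including the yᵢ : Yᵢ; hence X ∉ nmᶜ Λ also
    -- covers X ∉ {Y₁,…,Yₖ}.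
    i-cond : ∀ {Λ k} (ys : Vec (Fin n) (suc k)) d (Ys : Vec Name (suc k)) X →
      GroundCtx Λ →
      (∀ i → lookup Λ (lookup ys i) ≡ gnd (name (lookup Ys i))) →
      X ∉ nmᶜ Λ →
      Λ ⊢ cond ys d ∶ pos (gnd (name X))

    i-var : ∀ {Θ x P} →
      lookup Θ x ≡ P → (∀ y → y ≢ x → GroundEntry (lookup Θ y)) →
      Θ ⊢ val (var x) ∶ pos P

    i-let : ∀ {Θ Θ₁ Θ₂ u t P A} →
      Θ ≡ Θ₁ ⊎ Θ₂ →
      Θ₁ ⊢ u ∶ pos P → P ∷ Θ₂ ⊢ t ∶ A →
      Θ ⊢ let′ u t ∶ A

    i-pair : ∀ {Λ v w L₁ L₂} →
      GroundCtx Λ →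
      Λ ⊢ val v ∶ pos (gnd L₁) → Λ ⊢ val w ∶ pos (gnd L₂) →
      Λ ⊢ val ⟨ v , w ⟩ ∶ pos (gnd (L₁ ⊗ L₂))

    i-letp : ∀ {Θ v t L₁ L₂ A} →
      groundPart Θ ⊢ val v ∶ pos (gnd (L₁ ⊗ L₂)) →
      gnd L₂ ∷ gnd L₁ ∷ Θ ⊢ t ∶ A →
      Θ ⊢ letp v t ∶ A

    i-abs : ∀ {Θ t P A} →
      P ∷ Θ ⊢ t ∶ A →
      Θ ⊢ lam t ∶ P ⊸ A

    i-app : ∀ {Θ Θ₁ Θ₂ t v P A} →
      Θ ≡ Θ₁ ⊎ Θ₂ →
      Θ₁ ⊢ t ∶ P ⊸ A → Θ₂ ⊢ val v ∶ pos P →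
      Θ ⊢ t · v ∶ A

    i-bang : ∀ {Θ t As} →
      Θ ⊢! t ∶ As →
      Θ ⊢ val (! t) ∶ pos (bag As)

    i-der : ∀ {Θ v A} →
      Θ ⊢ val v ∶ pos (bag [ A ]) →
      Θ ⊢ der v ∶ A

    -- Not a rule of the calculus: it identifies lists representing the same
    -- multiset, and is transparent to everything computed from a derivation.
    i-≅ : ∀ {Θ Θ′ t A A′} →
      Θ ≅ᶜ Θ′ → A ≅ A′ →
      Θ ⊢ t ∶ A →
      Θ′ ⊢ t ∶ A′

  -- Θ ⊢! t ∶ A₁ ∷ … ∷ Aₘ ∷ []: the family of premises Λ,Γᵢ ⊢ t : Aᵢ (1 ≤ i ≤ m)
  -- of i-bang, where Θ = Λ,⊎ᵢΓᵢ.
  data _⊢!_∶_ {n} where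
    nil  : ∀ {Λ t} → GroundCtx Λ → Λ ⊢! t ∶ []
    cons : ∀ {Θ Θ₁ Θ₂ t A As} →
      Θ ≡ Θ₁ ⊎ Θ₂ →
      Θ₁ ⊢ t ∶ A → Θ₂ ⊢! t ∶ As →
      Θ ⊢! t ∶ A ∷ As

  mutual
    mainNames : ∀ {n} {Θ : Ctx n} {t A} → Θ ⊢ t ∶ A → List Name
    mainNames (i-sample X _ _)       = [ X ]
    mainNames (i-cond _ _ _ X _ _ _) = [ X ]
    mainNames (i-var _ _)            = []
    mainNames (i-let _ π₁ π₂)        = mainNames π₁ ++ mainNames π₂
    mainNames (i-pair _ π₁ π₂)       = mainNames π₁ ++ mainNames π₂
    mainNames (i-letp π₁ π₂)         = mainNames π₁ ++ mainNames π₂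
    mainNames (i-abs π)              = mainNames π
    mainNames (i-app _ π₁ π₂)        = mainNames π₁ ++ mainNames π₂
    mainNames (i-bang πs)            = mainNames! πs
    mainNames (i-der π)              = mainNames π
    mainNames (i-≅ _ _ π)            = mainNames π

    mainNames! : ∀ {n} {Θ : Ctx n} {t As} → Θ ⊢! t ∶ As → List Name
    mainNames! (nil _)       = []
    mainNames! (cons _ π πs) = mainNames π ++ mainNames! πs

  record Derivation {n} (Θ : Ctx n) (t : Term n) (A : Ty) : Set (c ⊔ ℓ) where
    field
      tree   : Θ ⊢ t ∶ A
      naming : Unique (mainNames tree)

  open Derivation public

  ----------------------------------------------------------------------
  -- Factors

  record Factor : Set c where
    field
      nm : NameSet
      fn : Val nm → Carrier

  open Factor public

  infix 4 _≋_

  -- Equality of factors: the same set of names, and the same value at every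
  -- valuation of it.
  record _≋_ (φ ψ : Factor) : Set ℓ where
    field
      nm-⊆ : elems (nm φ) ⊆ elems (nm ψ)
      nm-⊇ : elems (nm ψ) ⊆ elems (nm φ)
      fn-≈ : ∀ x̄ → fn φ x̄ ≈ fn ψ (restrict (nm φ) (nm ψ) nm-⊇ x̄)

  ∑-Val : ∀ Xs → (All (λ (_ : Name) → Bool) Xs → Carrier) → Carrier
  ∑-Val []       f = f []
  ∑-Val (_ ∷ Xs) f = ∑-Val Xs (λ x̄ → f (true ∷ x̄)) + ∑-Val Xs (λ x̄ → f (false ∷ x̄))

  sumOut : (ℤ : NameSet) (φ : Factor) → .(elems ℤ ⊆ elems (nm φ)) → Factor
  sumOut ℤ φ _ = record
    { nm = nm φ ∖ ℤ
    ; fn = λ ȳ → ∑-Val (elems ℤ) (λ z̄ → fn φ (glue (nm φ) ℤ z̄ ȳ))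
    }

  infixl 7 _⊙_

  _⊙_ : Factor → Factor → Factor
  φ ⊙ ψ = record
    { nm = nm φ ∪ nm ψ
    ; fn = λ z̄ → fn φ (restrict (nm φ ∪ nm ψ) (nm φ) (⊆-∪ˡ (nm φ) (nm ψ)) z̄)
               * fn ψ (restrict (nm φ ∪ nm ψ) (nm ψ) (⊆-∪ʳ (nm φ) (nm ψ)) z̄)
    }

  𝟏∅ : Factor
  𝟏∅ = record { nm = ∅ ; fn = λ _ → 1# }

  ⨀ : List Factor → Factor
  ⨀ = foldr _⊙_ 𝟏∅

  -- ∑_{Nm(φ) − 𝕐} φ
  sumOutside : NameSet → Factor → Factor
  sumOutside 𝕐 φ = sumOut (nm φ ∖ 𝕐) φ (∖-⊆ (nm φ) 𝕐)

  sampleFactor : Name → Dist → Factor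
  sampleFactor X d = record
    { nm = ⁅ X ⁆
    ; fn = λ x̄ → prob d (All.lookup x̄ (here refl))
    }

  condFactor : ∀ {k} → Vec Name (suc k) → Name → (Vec Bool (suc k) → Dist) → Factor
  condFactor {k} Ys X d = record
    { nm = 𝕐 ∪ ⁅ X ⁆
    ; fn = λ x̄ → prob (d (Vec.tabulate (λ i → All.lookup x̄ (Yᵢ∈ i)))) (All.lookup x̄ X∈)
    }
    where
    𝕐 : NameSet
    𝕐 = fromList (Vec.toList Ys)

    Yᵢ∈ : (i : Fin (suc k)) → lookup Ys i ∈ elems (𝕐 ∪ ⁅ X ⁆)
    Yᵢ∈ i = ⊆-∪ˡ 𝕐 ⁅ X ⁆ (∈-deduplicate⁺ _≟_ (∈-toList⁺ (∈-lookup i Ys)))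

    X∈ : X ∈ elems (𝕐 ∪ ⁅ X ⁆)
    X∈ = ⊆-∪ʳ 𝕐 ⁅ X ⁆ (here refl)

  ----------------------------------------------------------------------
  -- Semantics of a derivation

  mutual
    cpts : ∀ {n} {Θ : Ctx n} {t A} → Θ ⊢ t ∶ A → List Factor
    cpts (i-sample {d = d} X _ _)    = [ sampleFactor X d ]
    cpts (i-cond _ d Ys X _ _ _)     = [ condFactor Ys X d ]
    cpts (i-var _ _)                 = []
    cpts (i-let _ π₁ π₂)             = cpts π₁ ++ cpts π₂
    cpts (i-pair _ π₁ π₂)            = cpts π₁ ++ cpts π₂
    cpts (i-letp π₁ π₂)              = cpts π₁ ++ cpts π₂
    cpts (i-abs π)                   = cpts π
    cpts (i-app _ π₁ π₂)             = cpts π₁ ++ cpts π₂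
    cpts (i-bang πs)                 = cpts! πs
    cpts (i-der π)                   = cpts π
    cpts (i-≅ _ _ π)                 = cpts π

    cpts! : ∀ {n} {Θ : Ctx n} {t As} → Θ ⊢! t ∶ As → List Factor
    cpts! (nil _)       = []
    cpts! (cons _ π πs) = cpts π ++ cpts! πs

  -- The set 𝕏 = ⋃ {Nm(φ) | φ ∈ Cpts(π)} is the set of names of the product.
  ⟦_⟧ : ∀ {n} {Θ : Ctx n} {t A} → Derivation Θ t A → Factor
  ⟦_⟧ {Θ = Θ} {A = A} π = sumOutside (nmᴶ Θ A) (⨀ (cpts (tree π)))

  ----------------------------------------------------------------------
  -- Inductive decoration. At i-let and i-app, Nm(Λ,Γ₁,Γ₂,A) is the set of names
  -- of the conclusion.

  mutual
    decorate : ∀ {n} {Θ : Ctx n} {t A} → Θ ⊢ t ∶ A → Factor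
    decorate (i-sample {d = d} X _ _)                = sampleFactor X d
    decorate (i-cond _ d Ys X _ _ _)                 = condFactor Ys X d
    decorate (i-var _ _)                             = 𝟏∅
    decorate {Θ = Θ} {A = A} (i-let _ π₁ π₂)         =
      sumOutside (nmᴶ Θ A) (decorate π₁ ⊙ decorate π₂)
    decorate (i-pair _ _ _)                          = 𝟏∅
    decorate (i-letp _ π₂)                           = decorate π₂
    decorate (i-abs π)                               = decorate π
    decorate {Θ = Θ} {A = A} (i-app _ π₁ π₂)         =
      sumOutside (nmᴶ Θ A) (decorate π₁ ⊙ decorate π₂)
    decorate (i-bang πs)                             = ⨀ (decorate! πs)
    decorate (i-der π)                               = decorate π
    decorate (i-≅ _ _ π)                             = decorate π

    decorate! : ∀ {n} {Θ : Ctx n} {t As} → Θ ⊢! t ∶ As → List Factor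
    decorate! (nil _)       = []
    decorate! (cons _ π πs) = decorate π ∷ decorate! πs

{-# OPTIONS --safe #-}

-- Both sides multiply the same factors; they differ in when names are summed out.
-- A sum can be moved outwards past a product as soon as the names it removes from
-- one premise occur neither in the other premise's factors nor in the conclusion.
-- For an arbitrary judgment this may fail: a type in the context may mention a name
-- Y that an axiom in a subderivation also happens to use. It is excluded when the
-- final judgment is ground, by a realizability argument for each name Y. Atoms
-- mentioning Y have no realizer, the other atoms have only the clean one, and any
-- realized type that mentions Y also has a tainted realizer. A derivation whose main
-- names omit Y is sound, and if it uses Y it turns realizers of its context into a
-- tainted realizer of its conclusion; a judgment not mentioning Y is realized by the
-- clean element only. So a name Y introduced and summed out in one premise, but used
-- in the other, would produce a tainted realizer of the final ground type.

module Submission where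

open import Algebra.Bundles using (CommutativeSemiring; CommutativeMonoid)
open import Data.Bool.Base using (Bool; true; false; _∨_)
open import Data.Bool.Properties
  using (∨-assoc; ∨-comm; ∨-identityʳ; ∨-zeroʳ; ∨-commutativeMonoid)
open import Data.Fin.Base using (zero; suc)
open import Data.List.Base using (List; []; _∷_; _++_)
open import Data.List.Membership.Propositional using (_∈_; _∉_)
open import Data.List.Membership.Propositional.Properties
  using (∈-++⁺ˡ; ∈-++⁺ʳ; ∈-++⁻; ∈-filter⁺; ∈-filter⁻; ∈-deduplicate⁺; ∈-deduplicate⁻)
open import Data.List.Membership.Propositional.Properties.WithK using (unique∧set⇒bag)
open import Data.List.Properties using (++-assoc)
open import Data.List.Relation.Binary.BagAndSetEquality using (∼bag⇒↭)
open import Data.List.Relation.Binary.Disjoint.Propositional using (Disjoint)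
open import Data.List.Relation.Binary.Permutation.Homogeneous
  using (Permutation; refl; prep; swap; trans)
open import Data.List.Relation.Binary.Permutation.Propositional as ↭
  using (_↭_; ↭-refl; ↭-trans; ↭-reflexive; ↭-sym)
open import Data.List.Relation.Binary.Permutation.Propositional.Properties
  using (++⁺; ++⁺ʳ; ++-comm; ∈-resp-↭)
open import Data.List.Relation.Binary.Pointwise.Base using (Pointwise; []; _∷_)
open import Data.List.Relation.Binary.Subset.Propositional using (_⊆_)
open import Data.List.Relation.Unary.All as All using (All; []; _∷_)
import Data.List.Relation.Unary.All.Properties as All
open import Data.List.Relation.Unary.AllPairs using ([]; _∷_)
open import Data.List.Relation.Unary.Any using (Any; here; there)
import Data.List.Relation.Unary.Any.Properties as Any
open import Data.List.Relation.Unary.Unique.Propositional using (Unique)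
import Data.List.Relation.Unary.Unique.Propositional.Properties as Unique
open import Data.Nat using (ℕ)
open import Data.Nat.Properties using (_≟_)
open import Data.Product.Base using (_×_; _,_; proj₁; proj₂; ∃₂)
import Data.Sum.Base as Sum
open Sum using (inj₁; inj₂)
open import Data.Vec.Base as Vec using (Vec; []; _∷_; lookup)
open import Data.Vec.Membership.Propositional.Properties using (∈-toList⁻)
open import Data.Vec.Relation.Unary.Any using (index)
open import Data.Vec.Relation.Unary.Any.Properties using (lookup-index)
open import Function.Base using (_∘_; id)
open import Function.Bundles using (mk⇔)
open import Level using (Level; _⊔_)
open import Relation.Binary.PropositionalEquality as ≡
  using (_≡_; _≢_; refl; sym; cong; cong₂; subst)
import Relation.Binary.Reasoning.Setoid as SetoidReasoning
open import Relation.Nullary using (¬_; ¬?; yes; no; contradiction)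
open import Algebra.Properties.CommutativeSemigroup
  (CommutativeMonoid.commutativeSemigroup ∨-commutativeMonoid) using (interchange)
open import Data.List.Membership.DecPropositional _≟_ using (_∈?_)
open import Defs

-- Names of types and contexts

∈-nmᶜ⁺ : ∀ {n} (Θ : Ctx n) {Y} x → Y ∈ nmᵖ (lookup Θ x) → Y ∈ nmᶜ Θ
∈-nmᶜ⁺ (P ∷ Θ) zero    p = ∈-++⁺ˡ p
∈-nmᶜ⁺ (P ∷ Θ) (suc x) p = ∈-++⁺ʳ (nmᵖ P) (∈-nmᶜ⁺ Θ x p)

mutual
  ≅ᵖ⇒nm↭ : ∀ {P Q} → P ≅ᵖ Q → nmᵖ P ↭ nmᵖ Q
  ≅ᵖ⇒nm↭ gnd        = ↭-refl
  ≅ᵖ⇒nm↭ (bag As≅Bs) = ≅*⇒nm↭ As≅Bs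

  ≅⇒nm↭ : ∀ {A B} → A ≅ B → nmᵗ A ↭ nmᵗ B
  ≅⇒nm↭ (pos P≅Q)   = ≅ᵖ⇒nm↭ P≅Q
  ≅⇒nm↭ (P≅Q ⊸ A≅B) = ++⁺ (≅ᵖ⇒nm↭ P≅Q) (≅⇒nm↭ A≅B)

  ≅*⇒nm↭ : ∀ {As Bs} → Permutation _≅_ As Bs → nm* As ↭ nm* Bs
  ≅*⇒nm↭ (refl As≅Bs)     = pointwise⇒nm↭ As≅Bs
  ≅*⇒nm↭ (prep A≅B As≅Bs) = ++⁺ (≅⇒nm↭ A≅B) (≅*⇒nm↭ As≅Bs)
  ≅*⇒nm↭ (swap {As} {x = A} {y = B} A≅A′ B≅B′ As≅Bs) =
    ↭-trans (↭-reflexive (sym (++-assoc (nmᵗ A) (nmᵗ B) (nm* As))))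
      (↭-trans (++⁺ʳ (nm* As) (++-comm (nmᵗ A) (nmᵗ B)))
      (↭-trans (↭-reflexive (++-assoc (nmᵗ B) (nmᵗ A) (nm* As)))
      (++⁺ (≅⇒nm↭ B≅B′) (++⁺ (≅⇒nm↭ A≅A′) (≅*⇒nm↭ As≅Bs)))))
  ≅*⇒nm↭ (trans As≅Bs Bs≅Cs) = ↭-trans (≅*⇒nm↭ As≅Bs) (≅*⇒nm↭ Bs≅Cs)

  pointwise⇒nm↭ : ∀ {As Bs} → Pointwise _≅_ As Bs → nm* As ↭ nm* Bs
  pointwise⇒nm↭ []            = ↭-refl
  pointwise⇒nm↭ (A≅B ∷ As≅Bs) = ++⁺ (≅⇒nm↭ A≅B) (pointwise⇒nm↭ As≅Bs)

≅ᶜ⇒nm↭ : ∀ {n} (Θ Θ′ : Ctx n) → Θ ≅ᶜ Θ′ → nmᶜ Θ ↭ nmᶜ Θ′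
≅ᶜ⇒nm↭ []      []        _    = ↭-refl
≅ᶜ⇒nm↭ (P ∷ Θ) (P′ ∷ Θ′) Θ≅Θ′ = ++⁺ (≅ᵖ⇒nm↭ (Θ≅Θ′ zero)) (≅ᶜ⇒nm↭ Θ Θ′ (Θ≅Θ′ ∘ suc))

nm*-++ : ∀ As Bs → nm* (As ++ Bs) ≡ nm* As ++ nm* Bs
nm*-++ []       Bs = refl
nm*-++ (A ∷ As) Bs =
  ≡.trans (cong (nmᵗ A ++_) (nm*-++ As Bs)) (sym (++-assoc (nmᵗ A) (nm* As) (nm* Bs)))

module _ {Y : Name} where

  ∈-⊎ᵖ⁻ : ∀ {P P₁ P₂} → P ≡ P₁ ⊎ᵖ P₂ → Y ∈ nmᵖ P → Y ∈ nmᵖ P₁ Sum.⊎ Y ∈ nmᵖ P₂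
  ∈-⊎ᵖ⁻ gnd                 p = inj₁ p
  ∈-⊎ᵖ⁻ (bag {As} {Bs}) p = ∈-++⁻ (nm* As) (subst (Y ∈_) (nm*-++ As Bs) p)

  ∈-⊎ᵖ⁺ : ∀ {P P₁ P₂} → P ≡ P₁ ⊎ᵖ P₂ → Y ∈ nmᵖ P₁ Sum.⊎ Y ∈ nmᵖ P₂ → Y ∈ nmᵖ P
  ∈-⊎ᵖ⁺ gnd             (inj₁ p) = p
  ∈-⊎ᵖ⁺ gnd             (inj₂ p) = p
  ∈-⊎ᵖ⁺ (bag {As} {Bs}) (inj₁ p) = subst (Y ∈_) (sym (nm*-++ As Bs)) (∈-++⁺ˡ p)
  ∈-⊎ᵖ⁺ (bag {As} {Bs}) (inj₂ p) = subst (Y ∈_) (sym (nm*-++ As Bs)) (∈-++⁺ʳ (nm* As) p)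

  ∈-⊎⁻ : ∀ {n} (Θ Θ₁ Θ₂ : Ctx n) → Θ ≡ Θ₁ ⊎ Θ₂ →
         Y ∈ nmᶜ Θ → Y ∈ nmᶜ Θ₁ Sum.⊎ Y ∈ nmᶜ Θ₂
  ∈-⊎⁻ (P ∷ Θ) (P₁ ∷ Θ₁) (P₂ ∷ Θ₂) s p with ∈-++⁻ (nmᵖ P) p
  ... | inj₁ q = Sum.map ∈-++⁺ˡ ∈-++⁺ˡ (∈-⊎ᵖ⁻ (s zero) q)
  ... | inj₂ q = Sum.map (∈-++⁺ʳ (nmᵖ P₁)) (∈-++⁺ʳ (nmᵖ P₂)) (∈-⊎⁻ Θ Θ₁ Θ₂ (s ∘ suc) q)

  ∈-⊎⁺ : ∀ {n} (Θ Θ₁ Θ₂ : Ctx n) → Θ ≡ Θ₁ ⊎ Θ₂ →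
         Y ∈ nmᶜ Θ₁ Sum.⊎ Y ∈ nmᶜ Θ₂ → Y ∈ nmᶜ Θ
  ∈-⊎⁺ []      []        []        s (inj₁ ())
  ∈-⊎⁺ []      []        []        s (inj₂ ())
  ∈-⊎⁺ (P ∷ Θ) (P₁ ∷ Θ₁) (P₂ ∷ Θ₂) s (inj₁ p) with ∈-++⁻ (nmᵖ P₁) p
  ... | inj₁ q = ∈-++⁺ˡ (∈-⊎ᵖ⁺ (s zero) (inj₁ q))
  ... | inj₂ q = ∈-++⁺ʳ (nmᵖ P) (∈-⊎⁺ Θ Θ₁ Θ₂ (s ∘ suc) (inj₁ q))
  ∈-⊎⁺ (P ∷ Θ) (P₁ ∷ Θ₁) (P₂ ∷ Θ₂) s (inj₂ p) with ∈-++⁻ (nmᵖ P₂) p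
  ... | inj₁ q = ∈-++⁺ˡ (∈-⊎ᵖ⁺ (s zero) (inj₂ q))
  ... | inj₂ q = ∈-++⁺ʳ (nmᵖ P) (∈-⊎⁺ Θ Θ₁ Θ₂ (s ∘ suc) (inj₂ q))

groundPart-nm⊆ : ∀ {n} (Θ : Ctx n) {Y} → Y ∈ nmᶜ (groundPart Θ) → Y ∈ nmᶜ Θ
groundPart-nm⊆ (gnd L ∷ Θ) p with ∈-++⁻ (nmᵍ L) p
... | inj₁ q = ∈-++⁺ˡ q
... | inj₂ q = ∈-++⁺ʳ (nmᵍ L) (groundPart-nm⊆ Θ q)
groundPart-nm⊆ (bag As ∷ Θ) p = ∈-++⁺ʳ (nm* As) (groundPart-nm⊆ Θ p)

-- Boolean realizability for a fixed name.

module Realizability (Y : Name) where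

  infix 4 _⊩ᵖ_ _⊩*_ _⊩_ _⊩ᶜ_ _⊨[_]_

  -- `true` is the tainted realizer, `false` the clean one. Ground resources may be
  -- duplicated and discarded, which is why they have no tainted realizer.
  mutual
    _⊩ᵖ_ : Bool → Pos → Set
    m ⊩ᵖ gnd L  = m ≡ false × Y ∉ nmᵍ L
    m ⊩ᵖ bag As = m ⊩* As

    _⊩*_ : Bool → List Ty → Set
    m ⊩* []     = m ≡ false
    m ⊩* A ∷ As = ∃₂ λ a b → m ≡ a ∨ b × a ⊩ A × b ⊩* As

    _⊩_ : Bool → Ty → Set
    m ⊩ pos P = m ⊩ᵖ P
    m ⊩ P ⊸ A = ∀ k → k ⊩ᵖ P → m ∨ k ⊩ A

  _⊩ᶜ_ : ∀ {n} → Bool → Ctx n → Set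
  m ⊩ᶜ []    = m ≡ false
  m ⊩ᶜ P ∷ Θ = ∃₂ λ a b → m ≡ a ∨ b × a ⊩ᵖ P × b ⊩ᶜ Θ

  -- For τ = false this is soundness; for τ = true the derivation itself adds a taint.
  _⊨[_]_ : ∀ {n} → Ctx n → Bool → Ty → Set
  Θ ⊨[ τ ] A = ∀ m → m ⊩ᶜ Θ → τ ∨ m ⊩ A

  mutual
    -- Some realizer is assumed because a ground type mentioning `Y` has none. At `P ⊸ A` with `Y`
    -- in `P`, every argument realizer can be replaced by the tainted one, whose taint the function
    -- then passes on to `A`; with `Y` in `A`, the result itself is tainted.
    taintᵖ : ∀ P {m} → Y ∈ nmᵖ P → m ⊩ᵖ P → true ⊩ᵖ P
    taintᵖ (gnd L)  p (_ , q) = contradiction p q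
    taintᵖ (bag As) p r       = taint* As p r

    taint* : ∀ As {m} → Y ∈ nm* As → m ⊩* As → true ⊩* As
    taint* (A ∷ As) p (a , b , _ , r , s) with ∈-++⁻ (nmᵗ A) p
    ... | inj₁ q = true , b , refl , taint A q r , s
    ... | inj₂ q = a , true , sym (∨-zeroʳ a) , r , taint* As q s

    taint : ∀ A {m} → Y ∈ nmᵗ A → m ⊩ A → true ⊩ A
    taint (pos P) p r = taintᵖ P p r
    taint (P ⊸ A) {m} p r k s with ∈-++⁻ (nmᵖ P) p
    ... | inj₁ q = subst (_⊩ A) (∨-zeroʳ m) (r true (taintᵖ P q s))
    ... | inj₂ q = taint A q (r k s)

  taintᶜ : ∀ {n} (Θ : Ctx n) {m} → Y ∈ nmᶜ Θ → m ⊩ᶜ Θ → true ⊩ᶜ Θ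
  taintᶜ (P ∷ Θ) p (a , b , _ , r , s) with ∈-++⁻ (nmᵖ P) p
  ... | inj₁ q = true , b , refl , taintᵖ P q r , s
  ... | inj₂ q = a , true , sym (∨-zeroʳ a) , r , taintᶜ Θ q s

  mutual
    -- Existence and uniqueness of the clean realizer depend on each other at `P ⊸ A`: existence
    -- needs that arguments from `P` are clean, and uniqueness needs a clean argument to apply the
    -- function to.
    false-⊩ᵖ : ∀ P → Y ∉ nmᵖ P → false ⊩ᵖ P
    false-⊩ᵖ (gnd L)  p = refl , p
    false-⊩ᵖ (bag As) p = false-⊩* As p

    false-⊩* : ∀ As → Y ∉ nm* As → false ⊩* As
    false-⊩* []       p = refl
    false-⊩* (A ∷ As) p =
      false , false , refl , false-⊩ A (p ∘ ∈-++⁺ˡ) , false-⊩* As (p ∘ ∈-++⁺ʳ (nmᵗ A))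

    false-⊩ : ∀ A → Y ∉ nmᵗ A → false ⊩ A
    false-⊩ (pos P) p     = false-⊩ᵖ P p
    false-⊩ (P ⊸ A) p k r with refl ← ⊩ᵖ⇒false P (p ∘ ∈-++⁺ˡ) r =
      false-⊩ A (p ∘ ∈-++⁺ʳ (nmᵖ P))

    ⊩ᵖ⇒false : ∀ P {m} → Y ∉ nmᵖ P → m ⊩ᵖ P → m ≡ false
    ⊩ᵖ⇒false (gnd L)  p (e , _) = e
    ⊩ᵖ⇒false (bag As) p r       = ⊩*⇒false As p r

    ⊩*⇒false : ∀ As {m} → Y ∉ nm* As → m ⊩* As → m ≡ false
    ⊩*⇒false []       p r = r
    ⊩*⇒false (A ∷ As) p (a , b , e , r , s) =
      ≡.trans e (cong₂ _∨_ (⊩⇒false A (p ∘ ∈-++⁺ˡ) r) (⊩*⇒false As (p ∘ ∈-++⁺ʳ (nmᵗ A)) s))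

    ⊩⇒false : ∀ A {m} → Y ∉ nmᵗ A → m ⊩ A → m ≡ false
    ⊩⇒false (pos P)     p r = ⊩ᵖ⇒false P p r
    ⊩⇒false (P ⊸ A) {m} p r = ≡.trans (sym (∨-identityʳ m))
      (⊩⇒false A (p ∘ ∈-++⁺ʳ (nmᵖ P)) (r false (false-⊩ᵖ P (p ∘ ∈-++⁺ˡ))))

  false-⊩ᶜ : ∀ {n} (Θ : Ctx n) → Y ∉ nmᶜ Θ → false ⊩ᶜ Θ
  false-⊩ᶜ []      p = refl
  false-⊩ᶜ (P ∷ Θ) p =
    false , false , refl , false-⊩ᵖ P (p ∘ ∈-++⁺ˡ) , false-⊩ᶜ Θ (p ∘ ∈-++⁺ʳ (nmᵖ P))

  ⊩ᶜ⇒false : ∀ {n} (Θ : Ctx n) {m} → Y ∉ nmᶜ Θ → m ⊩ᶜ Θ → m ≡ false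
  ⊩ᶜ⇒false []      p r = r
  ⊩ᶜ⇒false (P ∷ Θ) p (a , b , e , r , s) =
    ≡.trans e (cong₂ _∨_ (⊩ᵖ⇒false P (p ∘ ∈-++⁺ˡ) r) (⊩ᶜ⇒false Θ (p ∘ ∈-++⁺ʳ (nmᵖ P)) s))

  -- ⊸ is contravariant, so both directions are needed at once.
  mutual
    ⊩ᵖ-resp-≅ : ∀ {P Q} → P ≅ᵖ Q → (∀ m → m ⊩ᵖ P → m ⊩ᵖ Q) × (∀ m → m ⊩ᵖ Q → m ⊩ᵖ P)
    ⊩ᵖ-resp-≅ gnd         = (λ _ r → r) , (λ _ r → r)
    ⊩ᵖ-resp-≅ (bag As≅Bs) = ⊩*-resp-≅ As≅Bs

    ⊩-resp-≅ : ∀ {A B} → A ≅ B → (∀ m → m ⊩ A → m ⊩ B) × (∀ m → m ⊩ B → m ⊩ A)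
    ⊩-resp-≅ (pos P≅Q) = ⊩ᵖ-resp-≅ P≅Q
    ⊩-resp-≅ (P≅Q ⊸ A≅B) with ⊩ᵖ-resp-≅ P≅Q | ⊩-resp-≅ A≅B
    ... | P⇒Q , Q⇒P | A⇒B , B⇒A =
      (λ m r k s → A⇒B (m ∨ k) (r k (Q⇒P k s))) ,
      (λ m r k s → B⇒A (m ∨ k) (r k (P⇒Q k s)))

    ⊩*-resp-≅ : ∀ {As Bs} → Permutation _≅_ As Bs →
                (∀ m → m ⊩* As → m ⊩* Bs) × (∀ m → m ⊩* Bs → m ⊩* As)
    ⊩*-resp-≅ (refl As≅Bs)     = ⊩*-resp-pointwise As≅Bs
    ⊩*-resp-≅ (prep {x = A} {B} A≅B As≅Bs) = ⊩*-∷ {A} {B} (⊩-resp-≅ A≅B) (⊩*-resp-≅ As≅Bs)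
    ⊩*-resp-≅ (swap A≅A′ B≅B′ As≅Bs)
      with ⊩-resp-≅ A≅A′ | ⊩-resp-≅ B≅B′ | ⊩*-resp-≅ As≅Bs
    ... | f , f⁻ | g , g⁻ | h , h⁻ =
      (λ { m (a , _ , e , r , b , c , refl , s , t) →
           b , a ∨ c , ≡.trans e (x∨yz≡y∨xz a b c) , g b s , a , c , refl , f a r , h c t }) ,
      (λ { m (a , _ , e , r , b , c , refl , s , t) →
           b , a ∨ c , ≡.trans e (x∨yz≡y∨xz a b c) , f⁻ b s , a , c , refl , g⁻ a r , h⁻ c t })
      where
      x∨yz≡y∨xz : ∀ x y z → x ∨ (y ∨ z) ≡ y ∨ (x ∨ z)
      x∨yz≡y∨xz x y z = ≡.trans (sym (∨-assoc x y z))
        (≡.trans (cong (_∨ z) (∨-comm x y)) (∨-assoc y x z))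
    ⊩*-resp-≅ (trans As≅Bs Bs≅Cs) with ⊩*-resp-≅ As≅Bs | ⊩*-resp-≅ Bs≅Cs
    ... | f , f⁻ | g , g⁻ = (λ m r → g m (f m r)) , (λ m r → f⁻ m (g⁻ m r))

    ⊩*-resp-pointwise : ∀ {As Bs} → Pointwise _≅_ As Bs →
                        (∀ m → m ⊩* As → m ⊩* Bs) × (∀ m → m ⊩* Bs → m ⊩* As)
    ⊩*-resp-pointwise []            = (λ _ r → r) , (λ _ r → r)
    ⊩*-resp-pointwise {A ∷ _} {B ∷ _} (A≅B ∷ As≅Bs) =
      ⊩*-∷ {A} {B} (⊩-resp-≅ A≅B) (⊩*-resp-pointwise As≅Bs)

    ⊩*-∷ : ∀ {A B As Bs} →
           (∀ m → m ⊩ A → m ⊩ B) × (∀ m → m ⊩ B → m ⊩ A) →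
           (∀ m → m ⊩* As → m ⊩* Bs) × (∀ m → m ⊩* Bs → m ⊩* As) →
           (∀ m → m ⊩* (A ∷ As) → m ⊩* (B ∷ Bs)) × (∀ m → m ⊩* (B ∷ Bs) → m ⊩* (A ∷ As))
    ⊩*-∷ (f , f⁻) (g , g⁻) =
      (λ { m (a , b , e , r , s) → a , b , e , f a r , g b s }) ,
      (λ { m (a , b , e , r , s) → a , b , e , f⁻ a r , g⁻ b s })

  ⊩ᶜ-resp-≅ : ∀ {n} (Θ Θ′ : Ctx n) {m} → Θ ≅ᶜ Θ′ → m ⊩ᶜ Θ′ → m ⊩ᶜ Θ
  ⊩ᶜ-resp-≅ []      []        _    r = r
  ⊩ᶜ-resp-≅ (P ∷ Θ) (P′ ∷ Θ′) Θ≅Θ′ (a , b , e , r , s) =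
    a , b , e , proj₂ (⊩ᵖ-resp-≅ (Θ≅Θ′ zero)) a r , ⊩ᶜ-resp-≅ Θ Θ′ (Θ≅Θ′ ∘ suc) s

  ⊩*-++⁻ : ∀ As {Bs m} → m ⊩* (As ++ Bs) → ∃₂ λ a b → m ≡ a ∨ b × a ⊩* As × b ⊩* Bs
  ⊩*-++⁻ []       r = false , _ , refl , refl , r
  ⊩*-++⁻ (A ∷ As) (a , _ , refl , r , s) with ⊩*-++⁻ As s
  ... | b , c , refl , t , u = a ∨ b , c , sym (∨-assoc a b c) , (a , b , refl , r , t) , u

  ⊩ᵖ-⊎⁻ : ∀ {P P₁ P₂ m} → P ≡ P₁ ⊎ᵖ P₂ → m ⊩ᵖ P → ∃₂ λ a b → m ≡ a ∨ b × a ⊩ᵖ P₁ × b ⊩ᵖ P₂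
  ⊩ᵖ-⊎⁻ gnd             (e , p) = false , false , e , (refl , p) , (refl , p)
  ⊩ᵖ-⊎⁻ (bag {As} {Bs}) r       = ⊩*-++⁻ As r

  ⊩ᶜ-⊎⁻ : ∀ {n} (Θ Θ₁ Θ₂ : Ctx n) {m} → Θ ≡ Θ₁ ⊎ Θ₂ → m ⊩ᶜ Θ →
          ∃₂ λ a b → m ≡ a ∨ b × a ⊩ᶜ Θ₁ × b ⊩ᶜ Θ₂
  ⊩ᶜ-⊎⁻ []      []        []        _ r = false , false , r , refl , refl
  ⊩ᶜ-⊎⁻ (P ∷ Θ) (P₁ ∷ Θ₁) (P₂ ∷ Θ₂) s (_ , _ , e , r , t)
    with ⊩ᵖ-⊎⁻ (s zero) r | ⊩ᶜ-⊎⁻ Θ Θ₁ Θ₂ (s ∘ suc) t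
  ... | a₁ , a₂ , refl , r₁ , r₂ | b₁ , b₂ , refl , t₁ , t₂ =
    a₁ ∨ b₁ , a₂ ∨ b₂ , ≡.trans e (interchange a₁ a₂ b₁ b₂) ,
    (a₁ , b₁ , refl , r₁ , t₁) , (a₂ , b₂ , refl , r₂ , t₂)

  ⊩ᵖ-ground : ∀ {P m} → GroundEntry P → m ⊩ᵖ P → m ≡ false
  ⊩ᵖ-ground gnd   (e , _) = e
  ⊩ᵖ-ground empty e       = e

  ⊩ᶜ-ground : ∀ {n} (Λ : Ctx n) {m} → GroundCtx Λ → m ⊩ᶜ Λ → m ≡ false
  ⊩ᶜ-ground []      g r = r
  ⊩ᶜ-ground (P ∷ Λ) g (a , b , e , r , s) =
    ≡.trans e (cong₂ _∨_ (⊩ᵖ-ground (g zero) r) (⊩ᶜ-ground Λ (g ∘ suc) s))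

  ⊩ᶜ-gnd∉ : ∀ {n} (Θ : Ctx n) {m} x {L} → lookup Θ x ≡ gnd L → m ⊩ᶜ Θ → Y ∉ nmᵍ L
  ⊩ᶜ-gnd∉ (_ ∷ Θ) zero    refl (_ , _ , _ , (_ , p) , _) = p
  ⊩ᶜ-gnd∉ (_ ∷ Θ) (suc x) e    (_ , _ , _ , _ , r)       = ⊩ᶜ-gnd∉ Θ x e r

  -- Every other entry is ground or empty and contributes only `false`, so the disjunction `m`
  -- collapses to the component at `x`.
  ⊩ᶜ-lookup : ∀ {n} (Θ : Ctx n) {m} x → (∀ y → y ≢ x → GroundEntry (lookup Θ y)) →
              m ⊩ᶜ Θ → m ⊩ᵖ lookup Θ x
  ⊩ᶜ-lookup (P ∷ Θ) zero g (a , b , e , r , s)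
    with refl ← ⊩ᶜ-ground Θ (λ y → g (suc y) λ ()) s
    with refl ← ≡.trans e (∨-identityʳ a) = r
  ⊩ᶜ-lookup (P ∷ Θ) (suc x) g (a , b , e , r , s)
    with refl ← ⊩ᵖ-ground (g zero λ ()) r
    with refl ← e =
    ⊩ᶜ-lookup Θ x (λ y y≢x → g (suc y) λ { refl → y≢x refl }) s

  ⊩ᶜ-groundPart : ∀ {n} (Θ : Ctx n) {m} → m ⊩ᶜ Θ → false ⊩ᶜ groundPart Θ
  ⊩ᶜ-groundPart []           r = refl
  ⊩ᶜ-groundPart (gnd L ∷ Θ)  (_ , _ , _ , (_ , p) , s) =
    false , false , refl , (refl , p) , ⊩ᶜ-groundPart Θ s
  ⊩ᶜ-groundPart (bag As ∷ Θ) (_ , _ , _ , _ , s) =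
    false , false , refl , refl , ⊩ᶜ-groundPart Θ s

  -- Semantic judgments and the typing rules.

  ⊨-free : ∀ {n} (Θ : Ctx n) A → Y ∉ nmᶜ Θ → Y ∉ nmᵗ A → Θ ⊨[ false ] A
  ⊨-free Θ A p q m r with refl ← ⊩ᶜ⇒false Θ p r = false-⊩ A q

  ⊭-free : ∀ {n} (Θ : Ctx n) A → Y ∉ nmᶜ Θ → Y ∉ nmᵗ A → ¬ Θ ⊨[ true ] A
  ⊭-free Θ A p q h with () ← ⊩⇒false A q (h false (false-⊩ᶜ Θ p))

  -- A name in the context allows a tainted input, which soundness carries to the output; a name in
  -- the conclusion allows the output to be tainted directly. A mere occurrence of `Y` in the
  -- judgment thus acts like a taint.
  ⊨-taint : ∀ {n} (Θ : Ctx n) A → Y ∈ nmᶜ Θ Sum.⊎ Y ∈ nmᵗ A → Θ ⊨[ false ] A → Θ ⊨[ true ] A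
  ⊨-taint Θ A (inj₁ p) h m r = h true (taintᶜ Θ p r)
  ⊨-taint Θ A (inj₂ p) h m r = taint A p (h m r)

  -- Taints of premises combine by disjunction. The parameters `τ` and `σ` stay free so that one
  -- lemma serves both soundness, with both `false`, and tainting, with exactly one `true`.
  ⊨-let : ∀ {n} {Θ Θ₁ Θ₂ : Ctx n} {P A} τ σ → Θ ≡ Θ₁ ⊎ Θ₂ →
          Θ₁ ⊨[ τ ] pos P → (P ∷ Θ₂) ⊨[ σ ] A → Θ ⊨[ τ ∨ σ ] A
  ⊨-let {Θ = Θ} {Θ₁} {Θ₂} {A = A} τ σ s f g m r with ⊩ᶜ-⊎⁻ Θ Θ₁ Θ₂ s r
  ... | a , b , refl , r₁ , r₂ =
    subst (_⊩ A)
      (≡.trans (sym (∨-assoc σ (τ ∨ a) b))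
        (≡.trans (cong (_∨ b) (≡.trans (sym (∨-assoc σ τ a)) (cong (_∨ a) (∨-comm σ τ))))
          (∨-assoc (τ ∨ σ) a b)))
      (g ((τ ∨ a) ∨ b) (τ ∨ a , b , refl , f a r₁ , r₂))

  ⊨-app : ∀ {n} {Θ Θ₁ Θ₂ : Ctx n} {P A} τ σ → Θ ≡ Θ₁ ⊎ Θ₂ →
          Θ₁ ⊨[ τ ] P ⊸ A → Θ₂ ⊨[ σ ] pos P → Θ ⊨[ τ ∨ σ ] A
  ⊨-app {Θ = Θ} {Θ₁} {Θ₂} {A = A} τ σ s f g m r with ⊩ᶜ-⊎⁻ Θ Θ₁ Θ₂ s r
  ... | a , b , refl , r₁ , r₂ =
    subst (_⊩ A) (interchange τ a σ b) (f a r₁ (σ ∨ b) (g b r₂))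

  ⊨-cons : ∀ {n} {Θ Θ₁ Θ₂ : Ctx n} {A As} τ σ → Θ ≡ Θ₁ ⊎ Θ₂ →
           Θ₁ ⊨[ τ ] A → Θ₂ ⊨[ σ ] pos (bag As) → Θ ⊨[ τ ∨ σ ] pos (bag (A ∷ As))
  ⊨-cons {Θ = Θ} {Θ₁} {Θ₂} τ σ s f g m r with ⊩ᶜ-⊎⁻ Θ Θ₁ Θ₂ s r
  ... | a , b , refl , r₁ , r₂ = τ ∨ a , σ ∨ b , sym (interchange τ a σ b) , f a r₁ , g b r₂

  -- The value premise serves only to show that `Y` does not occur in `L₁ ⊗ L₂`; the two bound
  -- variables can then be given clean realizers.
  ⊨-letp : ∀ {n} {Θ : Ctx n} {L₁ L₂ A} τ → groundPart Θ ⊨[ false ] pos (gnd (L₁ ⊗ L₂)) →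
           (gnd L₂ ∷ gnd L₁ ∷ Θ) ⊨[ τ ] A → Θ ⊨[ τ ] A
  ⊨-letp {Θ = Θ} {L₁} τ f g m r with f false (⊩ᶜ-groundPart Θ r)
  ... | _ , p = g m (false , m , refl , (refl , p ∘ ∈-++⁺ʳ (nmᵍ L₁)) ,
                     (false , m , refl , (refl , p ∘ ∈-++⁺ˡ) , r))

  ⊨-abs : ∀ {n} {Θ : Ctx n} {P A} τ → (P ∷ Θ) ⊨[ τ ] A → Θ ⊨[ τ ] P ⊸ A
  ⊨-abs {A = A} τ f m r k s =
    subst (_⊩ A) (≡.trans (cong (τ ∨_) (∨-comm k m)) (sym (∨-assoc τ m k)))
      (f (k ∨ m) (k , m , refl , s , r))

  ⊨-der : ∀ {n} {Θ : Ctx n} {A} τ → Θ ⊨[ τ ] pos (bag (A ∷ [])) → Θ ⊨[ τ ] A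
  ⊨-der {A = A} τ f m r with f m r
  ... | a , _ , e , s , refl = subst (_⊩ A) (sym (≡.trans e (∨-identityʳ a))) s

  ⊨-≅ : ∀ {n} {Θ Θ′ : Ctx n} {A A′} τ → Θ ≅ᶜ Θ′ → A ≅ A′ → Θ ⊨[ τ ] A → Θ′ ⊨[ τ ] A′
  ⊨-≅ {Θ = Θ} {Θ′} τ Θ≅Θ′ A≅A′ f m r =
    proj₁ (⊩-resp-≅ A≅A′) (τ ∨ m) (f m (⊩ᶜ-resp-≅ Θ Θ′ Θ≅Θ′ r))

-- Sets of names and valuations

∈-∪⁻ : ∀ 𝕏 𝕐 {X} → X ∈ elems (𝕏 ∪ 𝕐) → X ∈ elems 𝕏 Sum.⊎ X ∈ elems 𝕐
∈-∪⁻ 𝕏 𝕐 p = ∈-++⁻ (elems 𝕏) (∈-deduplicate⁻ _≟_ (elems 𝕏 ++ elems 𝕐) p)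

∈-∖⁺ : ∀ 𝕏 𝕐 {X} → X ∈ elems 𝕏 → X ∉ elems 𝕐 → X ∈ elems (𝕏 ∖ 𝕐)
∈-∖⁺ 𝕏 𝕐 p q = ∈-filter⁺ (λ X → ¬? (X ∈? elems 𝕐)) p q

∈-∖⇒∉ : ∀ 𝕏 𝕐 {X} → X ∈ elems (𝕏 ∖ 𝕐) → X ∉ elems 𝕐
∈-∖⇒∉ 𝕏 𝕐 p = proj₂ (∈-filter⁻ (λ X → ¬? (X ∈? elems 𝕐)) {xs = elems 𝕏} p)

-- The double difference is the form taken by the name set of `sumOutside 𝕐 φ`; decidable membership
-- turns it back into an intersection.
∖∖-⊆ : ∀ 𝕏 𝕐 → elems (𝕏 ∖ (𝕏 ∖ 𝕐)) ⊆ elems 𝕐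
∖∖-⊆ 𝕏 𝕐 {X} p with X ∈? elems 𝕐
... | yes q = q
... | no  q = contradiction (∈-∖⁺ 𝕏 𝕐 (∖-⊆ 𝕏 (𝕏 ∖ 𝕐) p) q) (∈-∖⇒∉ 𝕏 (𝕏 ∖ 𝕐) p)

∈-∖∖⁺ : ∀ 𝕏 𝕐 {X} → X ∈ elems 𝕏 → X ∈ elems 𝕐 → X ∈ elems (𝕏 ∖ (𝕏 ∖ 𝕐))
∈-∖∖⁺ 𝕏 𝕐 p q = ∈-∖⁺ 𝕏 (𝕏 ∖ 𝕐) p (λ r → ∈-∖⇒∉ 𝕏 𝕐 r q)

-- Without repetitions, mutual inclusion of name lists is already a permutation, and sums are
-- invariant under those.
unique-⊆-⊇⇒↭ : ∀ {Xs Ys : List Name} → Unique Xs → Unique Ys → Xs ⊆ Ys → Ys ⊆ Xs → Xs ↭ Ys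
unique-⊆-⊇⇒↭ Xs! Ys! Xs⊆Ys Ys⊆Xs = ∼bag⇒↭ (unique∧set⇒bag Xs! Ys! (mk⇔ Xs⊆Ys Ys⊆Xs))

Bits : List Name → Set
Bits = All (λ _ → Bool)

lookup-tabulate : ∀ {Xs : List Name} (f : ∀ {X} → X ∈ Xs → Bool) {X} (p : X ∈ Xs) →
                  All.lookup (All.tabulate f) p ≡ f p
lookup-tabulate f (here refl) = refl
lookup-tabulate f (there p)   = lookup-tabulate (f ∘ there) p

lookup-ext : ∀ {Xs} (x̄ ȳ : Bits Xs) →
             (∀ {X} (p : X ∈ Xs) → All.lookup x̄ p ≡ All.lookup ȳ p) → x̄ ≡ ȳ
lookup-ext []      []      h = refl
lookup-ext (x ∷ x̄) (y ∷ ȳ) h = cong₂ _∷_ (h (here refl)) (lookup-ext x̄ ȳ (h ∘ there))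

tabulate-cong : ∀ {Xs : List Name} (f g : ∀ {X} → X ∈ Xs → Bool) → (∀ {X} (p : X ∈ Xs) → f p ≡ g p) →
                All.tabulate f ≡ All.tabulate g
tabulate-cong f g h = lookup-ext _ _ λ p →
  ≡.trans (lookup-tabulate f p) (≡.trans (h p) (sym (lookup-tabulate g p)))

-- Total assignments and their updates.

Assignment : Set
Assignment = Name → Bool

infix 8 _↾_
infixl 6 _◁_

_↾_ : Assignment → ∀ Xs → Bits Xs
ρ ↾ Xs = All.tabulate (λ {X} _ → ρ X)

update : Name → Bool → Assignment → Assignment
update X b ρ Y with Y ≟ X
... | yes _ = b
... | no  _ = ρ Y

_◁_ : ∀ {Xs} → Assignment → Bits Xs → Assignment
ρ ◁ []            = ρ
ρ ◁ (_∷_ {X} b x̄) = update X b (ρ ◁ x̄)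

Agree : List Name → Assignment → Assignment → Set
Agree Xs ρ σ = ∀ {X} → X ∈ Xs → ρ X ≡ σ X

↾-cong : ∀ Xs {ρ σ} → Agree Xs ρ σ → ρ ↾ Xs ≡ σ ↾ Xs
↾-cong Xs {ρ} {σ} h = tabulate-cong (λ {X} _ → ρ X) (λ {X} _ → σ X) h

update-agree : ∀ {Xs ρ σ} X b → Agree Xs ρ σ → Agree Xs (update X b ρ) (update X b σ)
update-agree X b h {Y} p with Y ≟ X
... | yes _ = refl
... | no  _ = h p

update-≢ : ∀ X b ρ {Y} → Y ≢ X → update X b ρ Y ≡ ρ Y
update-≢ X b ρ {Y} Y≢X with Y ≟ X
... | yes Y≡X = contradiction Y≡X Y≢X
... | no  _   = refl

update-≡ : ∀ X b ρ → update X b ρ X ≡ b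
update-≡ X b ρ with X ≟ X
... | yes _   = refl
... | no  X≢X = contradiction refl X≢X

update-comm : ∀ {X Y} a b ρ → X ≢ Y → ∀ Z →
              update X a (update Y b ρ) Z ≡ update Y b (update X a ρ) Z
update-comm {X} {Y} a b ρ X≢Y Z with Z ≟ X | Z ≟ Y
... | yes refl | yes refl = contradiction refl X≢Y
... | yes refl | no  _    = sym (update-≡ Z a ρ)
... | no  _    | yes refl = update-≡ Z b ρ
... | no  Z≢X  | no  Z≢Y  = ≡.trans (update-≢ Y b ρ Z≢Y) (sym (update-≢ X a ρ Z≢X))

◁-∉ : ∀ {Xs} ρ (x̄ : Bits Xs) {Y} → Y ∉ Xs → (ρ ◁ x̄) Y ≡ ρ Y
◁-∉ ρ []            Y∉ = refl
◁-∉ ρ (_∷_ {X} b x̄) Y∉ = ≡.trans (update-≢ X b (ρ ◁ x̄) (Y∉ ∘ here)) (◁-∉ ρ x̄ (Y∉ ∘ there))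

◁-∈ : ∀ {Xs} → Unique Xs → ∀ ρ (x̄ : Bits Xs) {Y} (p : Y ∈ Xs) → (ρ ◁ x̄) Y ≡ All.lookup x̄ p
◁-∈ (_  ∷ _)   ρ (_∷_ {X} b x̄) (here refl) = update-≡ X b (ρ ◁ x̄)
◁-∈ (X∉ ∷ Xs!) ρ (_∷_ {X} b x̄) (there p)   =
  ≡.trans (update-≢ X b (ρ ◁ x̄) (λ Y≡X → All.lookup X∉ p (sym Y≡X))) (◁-∈ Xs! ρ x̄ p)

-- The local function inside `glue` cannot be named: the underscore stands for it.
mutual
  glue-↾ : ∀ 𝕏 ℤ (z̄ : Val ℤ) ρ → glue 𝕏 ℤ z̄ (ρ ↾ elems (𝕏 ∖ ℤ)) ≡ (ρ ◁ z̄) ↾ elems 𝕏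
  glue-↾ 𝕏 ℤ z̄ ρ = tabulate-cong _ (λ {X} _ → (ρ ◁ z̄) X) (glue-value 𝕏 ℤ z̄ ρ)

  glue-value : ∀ 𝕏 ℤ (z̄ : Val ℤ) ρ {X} (p : X ∈ elems 𝕏) → _ ≡ (ρ ◁ z̄) X
  glue-value 𝕏 ℤ z̄ ρ {X} p with X ∈? elems ℤ
  ... | yes X∈ℤ = sym (◁-∈ (unique ℤ) ρ z̄ X∈ℤ)
  ... | no  X∉ℤ = ≡.trans (lookup-tabulate (λ {Y} _ → ρ Y) (∈-filter⁺ (λ Y → ¬? (Y ∈? elems ℤ)) p X∉ℤ)) (sym (◁-∉ ρ z̄ X∉ℤ))

restrict-↾ : ∀ 𝕏 𝕐 (𝕐⊆𝕏 : elems 𝕐 ⊆ elems 𝕏) ρ → restrict 𝕏 𝕐 𝕐⊆𝕏 (ρ ↾ elems 𝕏) ≡ ρ ↾ elems 𝕐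
restrict-↾ 𝕏 𝕐 𝕐⊆𝕏 ρ = tabulate-cong (λ p → All.lookup (ρ ↾ elems 𝕏) (𝕐⊆𝕏 p)) (λ {X} _ → ρ X)
  (λ p → lookup-tabulate (λ {X} _ → ρ X) (𝕐⊆𝕏 p))

-- Sums, products and elimination of names in factors.

module FactorAlgebra {c ℓ : Level} (R : CommutativeSemiring c ℓ) where

  open Calculus R
  open CommutativeSemiring R
    hiding (refl; sym; reflexive; trans)
  open CommutativeSemiring R using ()
    renaming (refl to ≈-refl; sym to ≈-sym; trans to ≈-trans; reflexive to ≈-reflexive)
  open SetoidReasoning setoid
  open import Algebra.Properties.CommutativeSemigroup +-commutativeSemigroup
    using () renaming (interchange to +-interchange)

  Local : List Name → (Assignment → Carrier) → Set ℓ
  Local Xs f = ∀ {ρ σ} → Agree Xs ρ σ → f ρ ≈ f σ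

  Extensional : (Assignment → Carrier) → Set ℓ
  Extensional f = ∀ {ρ σ} → (∀ X → ρ X ≡ σ X) → f ρ ≈ f σ

  -- Since `ρ ◁ (b ∷ x̄)` performs the update of its head last, `∑ (X ∷ Xs) f ρ` unfolds by
  -- definition into the two sums `∑ Xs (f ∘ update X b) ρ`. The inductions on the list rest on
  -- this.
  ∑ : List Name → (Assignment → Carrier) → Assignment → Carrier
  ∑ Xs f ρ = ∑-Val Xs (λ x̄ → f (ρ ◁ x̄))

  ∑-Val-cong : ∀ Xs {f g : Bits Xs → Carrier} → (∀ x̄ → f x̄ ≈ g x̄) → ∑-Val Xs f ≈ ∑-Val Xs g
  ∑-Val-cong []       h = h []
  ∑-Val-cong (X ∷ Xs) h =
    +-cong (∑-Val-cong Xs (h ∘ (true ∷_))) (∑-Val-cong Xs (h ∘ (false ∷_)))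

  ∑-cong : ∀ Xs {f g} → (∀ ρ → f ρ ≈ g ρ) → ∀ ρ → ∑ Xs f ρ ≈ ∑ Xs g ρ
  ∑-cong Xs h ρ = ∑-Val-cong Xs (λ x̄ → h (ρ ◁ x̄))

  ∑-+ : ∀ Xs f g ρ → ∑ Xs (λ σ → f σ + g σ) ρ ≈ ∑ Xs f ρ + ∑ Xs g ρ
  ∑-+ []       f g ρ = ≈-refl
  ∑-+ (X ∷ Xs) f g ρ =
    ≈-trans (+-cong (∑-+ Xs (f ∘ update X true) (g ∘ update X true) ρ)
                    (∑-+ Xs (f ∘ update X false) (g ∘ update X false) ρ))
      (+-interchange _ _ _ _)

  -- The second list becomes the outer sum, because its updates are performed first.
  ∑-++ : ∀ Xs Ys f ρ → ∑ (Xs ++ Ys) f ρ ≈ ∑ Ys (∑ Xs f) ρ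
  ∑-++ []       Ys f ρ = ≈-refl
  ∑-++ (X ∷ Xs) Ys f ρ =
    ≈-trans (+-cong (∑-++ Xs Ys (f ∘ update X true) ρ) (∑-++ Xs Ys (f ∘ update X false) ρ))
      (≈-sym (∑-+ Ys (∑ Xs (f ∘ update X true)) (∑ Xs (f ∘ update X false)) ρ))

  ∑-local : ∀ {Xs} Zs f → Local Xs f → Local Xs (∑ Zs f)
  ∑-local []       f f-local h = f-local h
  ∑-local (Z ∷ Zs) f f-local h = +-cong
    (∑-local Zs _ (λ k → f-local (update-agree Z true k)) h)
    (∑-local Zs _ (λ k → f-local (update-agree Z false k)) h)

  -- The distributive law behind variable elimination: updating a name of `Zs` leaves `f` unchanged,
  -- so `f` is a constant of the sum.
  ∑-*ˡ : ∀ {Xs} Zs f g → Local Xs f → Disjoint Xs Zs →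
         ∀ ρ → ∑ Zs (λ σ → f σ * g σ) ρ ≈ f ρ * ∑ Zs g ρ
  ∑-*ˡ []       f g f-local dis ρ = ≈-refl
  ∑-*ˡ (Z ∷ Zs) f g f-local dis ρ = ≈-trans (+-cong (step true) (step false)) (≈-sym (distribˡ _ _ _))
    where
    Z∉ : ∀ {Y} → Y ∈ _ → Y ≢ Z
    Z∉ p refl = dis (p , here refl)

    step : ∀ b → ∑ Zs (λ σ → f (update Z b σ) * g (update Z b σ)) ρ ≈ f ρ * ∑ Zs (g ∘ update Z b) ρ
    step b = ≈-trans
      (∑-cong Zs (λ σ → *-congʳ {g (update Z b σ)} (f-local (λ p → update-≢ Z b σ (Z∉ p)))) ρ)
      (∑-*ˡ Zs f (g ∘ update Z b) f-local (λ { (p , q) → dis (p , there q) }) ρ)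

  update-ext : ∀ {f} X b → Extensional f → Extensional (f ∘ update X b)
  update-ext X b f-ext h = f-ext (λ Y → update-agree {Y ∷ []} X b (λ _ → h _) (here refl))

  -- Exchange of finite sums. Extensionality of `f` is required because two swapped updates agree
  -- only pointwise as assignments.
  ∑-↭ : ∀ {Xs Ys} → Xs ↭ Ys → ∀ f → Extensional f → ∀ ρ → ∑ Xs f ρ ≈ ∑ Ys f ρ
  ∑-↭ ↭.refl           f f-ext ρ = ≈-refl
  ∑-↭ (↭.prep X Xs↭Ys) f f-ext ρ = +-cong
    (∑-↭ Xs↭Ys _ (update-ext X true f-ext) ρ) (∑-↭ Xs↭Ys _ (update-ext X false f-ext) ρ)
  ∑-↭ (↭.swap {Xs} {Ys} X Y Xs↭Ys) f f-ext ρ with X ≟ Y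
  -- Repetitions are allowed in the list. For equal names both sides already have the same shape, so
  -- no exchange takes place.
  ... | yes refl = +-cong
    (+-cong (step true true) (step true false)) (+-cong (step false true) (step false false))
    where
    step : ∀ a b → ∑ Xs (f ∘ update X a ∘ update X b) ρ ≈ ∑ Ys (f ∘ update X a ∘ update X b) ρ
    step a b = ∑-↭ Xs↭Ys _ (update-ext X b (update-ext X a f-ext)) ρ
  ... | no X≢Y = ≈-trans
    (+-cong (+-cong (step true true) (step true false)) (+-cong (step false true) (step false false)))
    (+-interchange _ _ _ _)
    where
    step : ∀ a b → ∑ Xs (f ∘ update X a ∘ update Y b) ρ ≈ ∑ Ys (f ∘ update Y b ∘ update X a) ρ
    step a b = ≈-trans (∑-↭ Xs↭Ys _ (update-ext Y b (update-ext X a f-ext)) ρ)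
      (∑-cong Ys (λ σ → f-ext (update-comm a b σ X≢Y)) ρ)
  ∑-↭ (↭.trans Xs↭Ys Ys↭Zs) f f-ext ρ = ≈-trans (∑-↭ Xs↭Ys f f-ext ρ) (∑-↭ Ys↭Zs f f-ext ρ)

  -- A factor as a function of total assignments: products become pointwise, and
  -- no valuation has to be transported along an inclusion of name sets.
  ev : Factor → Assignment → Carrier
  ev φ ρ = fn φ (ρ ↾ elems (nm φ))

  ev-local : ∀ φ → Local (elems (nm φ)) (ev φ)
  ev-local φ h = ≈-reflexive (cong (fn φ) (↾-cong (elems (nm φ)) h))

  ev-⊙ : ∀ φ ψ ρ → ev (φ ⊙ ψ) ρ ≈ ev φ ρ * ev ψ ρ
  ev-⊙ φ ψ ρ = ≈-reflexive (cong₂ (λ x̄ ȳ → fn φ x̄ * fn ψ ȳ)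
    (restrict-↾ (nm φ ∪ nm ψ) (nm φ) (⊆-∪ˡ (nm φ) (nm ψ)) ρ)
    (restrict-↾ (nm φ ∪ nm ψ) (nm ψ) (⊆-∪ʳ (nm φ) (nm ψ)) ρ))

  ev-sumOutside : ∀ 𝕐 φ ρ → ev (sumOutside 𝕐 φ) ρ ≈ ∑ (elems (nm φ ∖ 𝕐)) (ev φ) ρ
  ev-sumOutside 𝕐 φ ρ = ∑-Val-cong (elems (nm φ ∖ 𝕐))
    (λ z̄ → ≈-reflexive (cong (fn φ) (glue-↾ (nm φ) (nm φ ∖ 𝕐) z̄ ρ)))

  infix 4 _≃_

  record _≃_ (φ ψ : Factor) : Set ℓ where
    field
      nm-⊆ : elems (nm φ) ⊆ elems (nm ψ)
      nm-⊇ : elems (nm ψ) ⊆ elems (nm φ)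
      ev-≈ : ∀ ρ → ev φ ρ ≈ ev ψ ρ

  open _≃_

  ≃-refl : ∀ {φ} → φ ≃ φ
  ≃-refl = record { nm-⊆ = id ; nm-⊇ = id ; ev-≈ = λ _ → ≈-refl }

  ≃-trans : ∀ {φ ψ χ} → φ ≃ ψ → ψ ≃ χ → φ ≃ χ
  ≃-trans φ≃ψ ψ≃χ = record
    { nm-⊆ = nm-⊆ ψ≃χ ∘ nm-⊆ φ≃ψ
    ; nm-⊇ = nm-⊇ φ≃ψ ∘ nm-⊇ ψ≃χ
    ; ev-≈ = λ ρ → ≈-trans (ev-≈ φ≃ψ ρ) (ev-≈ ψ≃χ ρ)
    }

  -- Each valuation of `nm φ` is the restriction of some total assignment, so comparing evaluations
  -- at all assignments covers all valuations.
  ≃⇒≋ : ∀ {φ ψ} → φ ≃ ψ → φ ≋ ψ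
  ≃⇒≋ {φ} {ψ} φ≃ψ = record
    { nm-⊆ = nm-⊆ φ≃ψ
    ; nm-⊇ = nm-⊇ φ≃ψ
    -- The default `true` is arbitrary: on `nm φ` it is overwritten by `x̄`, and `ψ` has no further
    -- names.
    ; fn-≈ = λ x̄ → let ρ = (λ _ → true) ◁ x̄ ; x̄≡ρ↾ = canonical x̄ in begin
        fn φ x̄                  ≡⟨ cong (fn φ) x̄≡ρ↾ ⟩
        ev φ ρ                  ≈⟨ ev-≈ φ≃ψ ρ ⟩
        ev ψ ρ                  ≡⟨ cong (fn ψ) (restrict-↾ (nm φ) (nm ψ) (nm-⊇ φ≃ψ) ρ) ⟨
        fn ψ (restrict (nm φ) (nm ψ) (nm-⊇ φ≃ψ) (ρ ↾ elems (nm φ)))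
          ≡⟨ cong (fn ψ ∘ restrict (nm φ) (nm ψ) (nm-⊇ φ≃ψ)) x̄≡ρ↾ ⟨
        fn ψ (restrict (nm φ) (nm ψ) (nm-⊇ φ≃ψ) x̄) ∎
    }
    where
    canonical : ∀ x̄ → x̄ ≡ ((λ _ → true) ◁ x̄) ↾ elems (nm φ)
    canonical x̄ = lookup-ext _ _ λ p → sym
      (≡.trans (lookup-tabulate (λ {X} _ → ((λ _ → true) ◁ x̄) X) p) (◁-∈ (unique (nm φ)) _ x̄ p))

  sumOutside-cong : ∀ 𝕐 𝕐′ {φ ψ} → φ ≃ ψ →
    (∀ {X} → X ∈ elems (nm φ) → X ∈ elems 𝕐 → X ∈ elems 𝕐′) →
    (∀ {X} → X ∈ elems (nm φ) → X ∈ elems 𝕐′ → X ∈ elems 𝕐) →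
    sumOutside 𝕐 φ ≃ sumOutside 𝕐′ ψ
  sumOutside-cong 𝕐 𝕐′ {φ} {ψ} φ≃ψ to from = record
    { nm-⊆ = λ p → let q = ∖-⊆ (nm φ) (nm φ ∖ 𝕐) p in
        ∈-∖∖⁺ (nm ψ) 𝕐′ (nm-⊆ φ≃ψ q) (to q (∖∖-⊆ (nm φ) 𝕐 p))
    ; nm-⊇ = λ p → let q = nm-⊇ φ≃ψ (∖-⊆ (nm ψ) (nm ψ ∖ 𝕐′) p) in
        ∈-∖∖⁺ (nm φ) 𝕐 q (from q (∖∖-⊆ (nm ψ) 𝕐′ p))
    ; ev-≈ = λ ρ → begin
        ev (sumOutside 𝕐 φ) ρ            ≈⟨ ev-sumOutside 𝕐 φ ρ ⟩
        ∑ (elems (nm φ ∖ 𝕐)) (ev φ) ρ    ≈⟨ ∑-cong (elems (nm φ ∖ 𝕐)) (ev-≈ φ≃ψ) ρ ⟩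
        ∑ (elems (nm φ ∖ 𝕐)) (ev ψ) ρ    ≈⟨ ∑-↭ same (ev ψ) (λ h → ev-local ψ (λ _ → h _)) ρ ⟩
        ∑ (elems (nm ψ ∖ 𝕐′)) (ev ψ) ρ   ≈⟨ ev-sumOutside 𝕐′ ψ ρ ⟨
        ev (sumOutside 𝕐′ ψ) ρ           ∎
    }
    where
    same : elems (nm φ ∖ 𝕐) ↭ elems (nm ψ ∖ 𝕐′)
    same = unique-⊆-⊇⇒↭ (unique (nm φ ∖ 𝕐)) (unique (nm ψ ∖ 𝕐′))
      (λ p → let q = ∖-⊆ (nm φ) 𝕐 p in
        ∈-∖⁺ (nm ψ) 𝕐′ (nm-⊆ φ≃ψ q) (∈-∖⇒∉ (nm φ) 𝕐 p ∘ from q))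
      (λ p → let q = nm-⊇ φ≃ψ (∖-⊆ (nm ψ) 𝕐′ p) in
        ∈-∖⁺ (nm φ) 𝕐 q (∈-∖⇒∉ (nm ψ) 𝕐′ p ∘ to q))

  sumOutside-⊇ : ∀ 𝕐 φ → elems (nm φ) ⊆ elems 𝕐 → sumOutside 𝕐 φ ≃ φ
  sumOutside-⊇ 𝕐 φ φ⊆𝕐 = record
    { nm-⊆ = ∖-⊆ (nm φ) (nm φ ∖ 𝕐)
    ; nm-⊇ = λ p → ∈-∖∖⁺ (nm φ) 𝕐 p (φ⊆𝕐 p)
    ; ev-≈ = λ ρ → ≈-trans (ev-sumOutside 𝕐 φ ρ)
        (∑-↭ (unique-⊆-⊇⇒↭ {Ys = []} (unique (nm φ ∖ 𝕐)) []
          (λ p → contradiction (φ⊆𝕐 (∖-⊆ (nm φ) 𝕐 p)) (∈-∖⇒∉ (nm φ) 𝕐 p)) λ ())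
          (ev φ) (λ h → ev-local φ (λ _ → h _)) ρ)
    }

  -- Products of families and the order of elimination.

  ∈-⨀⁻ : ∀ φs {X} → X ∈ elems (nm (⨀ φs)) → Any (λ φ → X ∈ elems (nm φ)) φs
  ∈-⨀⁻ (φ ∷ φs) p with ∈-∪⁻ (nm φ) (nm (⨀ φs)) p
  ... | inj₁ q = here q
  ... | inj₂ q = there (∈-⨀⁻ φs q)

  ∈-⨀⁺ : ∀ φs {X} → Any (λ φ → X ∈ elems (nm φ)) φs → X ∈ elems (nm (⨀ φs))
  ∈-⨀⁺ (φ ∷ φs) (here p)  = ⊆-∪ˡ (nm φ) (nm (⨀ φs)) p
  ∈-⨀⁺ (φ ∷ φs) (there p) = ⊆-∪ʳ (nm φ) (nm (⨀ φs)) (∈-⨀⁺ φs p)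

  ⨀-++ : ∀ φs ψs → ⨀ (φs ++ ψs) ≃ ⨀ φs ⊙ ⨀ ψs
  ⨀-++ φs ψs = record
    { nm-⊆ = λ p → Sum.[ (λ q → ⊆-∪ˡ (nm (⨀ φs)) (nm (⨀ ψs)) (∈-⨀⁺ φs q))
                       , (λ q → ⊆-∪ʳ (nm (⨀ φs)) (nm (⨀ ψs)) (∈-⨀⁺ ψs q)) ]
                       (Any.++⁻ φs (∈-⨀⁻ (φs ++ ψs) p))
    ; nm-⊇ = λ p → ∈-⨀⁺ (φs ++ ψs) (Sum.[ (λ q → Any.++⁺ˡ (∈-⨀⁻ φs q))
                                        , (λ q → Any.++⁺ʳ φs (∈-⨀⁻ ψs q)) ]
                                        (∈-∪⁻ (nm (⨀ φs)) (nm (⨀ ψs)) p))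
    ; ev-≈ = λ ρ → ≈-trans (ev-⨀-++ φs ρ) (≈-sym (ev-⊙ (⨀ φs) (⨀ ψs) ρ))
    }
    where
    ev-⨀-++ : ∀ φs ρ → ev (⨀ (φs ++ ψs)) ρ ≈ ev (⨀ φs) ρ * ev (⨀ ψs) ρ
    ev-⨀-++ []       ρ = ≈-sym (*-identityˡ _)
    ev-⨀-++ (φ ∷ φs) ρ = begin
      ev (φ ⊙ ⨀ (φs ++ ψs)) ρ                  ≈⟨ ev-⊙ φ (⨀ (φs ++ ψs)) ρ ⟩
      ev φ ρ * ev (⨀ (φs ++ ψs)) ρ             ≈⟨ *-congˡ (ev-⨀-++ φs ρ) ⟩
      ev φ ρ * (ev (⨀ φs) ρ * ev (⨀ ψs) ρ)     ≈⟨ *-assoc _ _ _ ⟨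
      ev φ ρ * ev (⨀ φs) ρ * ev (⨀ ψs) ρ       ≈⟨ *-congʳ (ev-⊙ φ (⨀ φs) ρ) ⟨
      ev (φ ⊙ ⨀ φs) ρ * ev (⨀ ψs) ρ            ∎

  ⨀-[-] : ∀ φ → ⨀ (φ ∷ []) ≃ φ
  ⨀-[-] φ = record
    { nm-⊆ = λ p → Sum.[ id , (λ ()) ] (∈-∪⁻ (nm φ) ∅ p)
    ; nm-⊇ = ⊆-∪ˡ (nm φ) ∅
    ; ev-≈ = λ ρ → ≈-trans (ev-⊙ φ 𝟏∅ ρ) (*-identityʳ _)
    }

  -- The names to be eliminated split into those private to `φ₁`, those private to `φ₂`, and the
  -- rest. By the separation hypotheses a private name occurs neither in the other factor nor in
  -- `𝕁`, so its sum may be taken inside the product.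
  sumOutside-⊙ : ∀ 𝕁₁ 𝕁₂ 𝕁 {φ₁ φ₂ ψ₁ ψ₂} →
    sumOutside 𝕁₁ φ₁ ≃ ψ₁ → sumOutside 𝕁₂ φ₂ ≃ ψ₂ →
    (∀ {X} → X ∈ elems (nm φ₁) → X ∉ elems 𝕁₁ → X ∉ elems 𝕁 × X ∉ elems (nm φ₂)) →
    (∀ {X} → X ∈ elems (nm φ₂) → X ∉ elems 𝕁₂ → X ∉ elems 𝕁 × X ∉ elems (nm φ₁)) →
    sumOutside 𝕁 (φ₁ ⊙ φ₂) ≃ sumOutside 𝕁 (ψ₁ ⊙ ψ₂)
  sumOutside-⊙ 𝕁₁ 𝕁₂ 𝕁 {φ₁} {φ₂} {ψ₁} {ψ₂} eq₁ eq₂ sep₁ sep₂ = record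
    { nm-⊆ = λ p → let q = ∖∖-⊆ (nm (φ₁ ⊙ φ₂)) 𝕁 p in
        ∈-∖∖⁺ (nm (ψ₁ ⊙ ψ₂)) 𝕁
          (Sum.[ (λ r → ⊆-∪ˡ (nm ψ₁) (nm ψ₂) (retained₁ r (λ r′ → proj₁ (sep₁ r r′) q)))
               , (λ r → ⊆-∪ʳ (nm ψ₁) (nm ψ₂) (retained₂ r (λ r′ → proj₁ (sep₂ r r′) q))) ]
            (∈-∪⁻ (nm φ₁) (nm φ₂) (∖-⊆ (nm (φ₁ ⊙ φ₂)) (nm (φ₁ ⊙ φ₂) ∖ 𝕁) p))) q
    ; nm-⊇ = λ p → ∈-∖∖⁺ (nm (φ₁ ⊙ φ₂)) 𝕁
          (ψ⊆φ (∖-⊆ (nm (ψ₁ ⊙ ψ₂)) (nm (ψ₁ ⊙ ψ₂) ∖ 𝕁) p)) (∖∖-⊆ (nm (ψ₁ ⊙ ψ₂)) 𝕁 p)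
    ; ev-≈ = λ ρ → begin
        ev (sumOutside 𝕁 (φ₁ ⊙ φ₂)) ρ
          ≈⟨ ev-sumOutside 𝕁 (φ₁ ⊙ φ₂) ρ ⟩
        ∑ (elems (nm (φ₁ ⊙ φ₂) ∖ 𝕁)) (ev (φ₁ ⊙ φ₂)) ρ
          ≈⟨ ∑-cong (elems (nm (φ₁ ⊙ φ₂) ∖ 𝕁)) (ev-⊙ φ₁ φ₂) ρ ⟩
        ∑ (elems (nm (φ₁ ⊙ φ₂) ∖ 𝕁)) F ρ
          ≈⟨ ∑-↭ partition F F-ext ρ ⟩
        ∑ ((N₂ ++ N₁) ++ Z) F ρ
          ≈⟨ ∑-++ (N₂ ++ N₁) Z F ρ ⟩
        ∑ Z (∑ (N₂ ++ N₁) F) ρ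
          ≈⟨ ∑-cong Z (λ σ → ≈-trans (∑-++ N₂ N₁ F σ) (factorise σ)) ρ ⟩
        ∑ Z (ev (ψ₁ ⊙ ψ₂)) ρ
          ≈⟨ ev-sumOutside 𝕁 (ψ₁ ⊙ ψ₂) ρ ⟨
        ev (sumOutside 𝕁 (ψ₁ ⊙ ψ₂)) ρ ∎
    }
    where
    N₁ N₂ Z : List Name
    N₁ = elems (nm φ₁ ∖ 𝕁₁)
    N₂ = elems (nm φ₂ ∖ 𝕁₂)
    Z  = elems (nm (ψ₁ ⊙ ψ₂) ∖ 𝕁)

    F : Assignment → Carrier
    F ρ = ev φ₁ ρ * ev φ₂ ρ

    F-ext : Extensional F
    F-ext h = *-cong (ev-local φ₁ (λ _ → h _)) (ev-local φ₂ (λ _ → h _))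

    -- The doubly negated hypothesis is what contraposition of `sep₁` yields; it suffices because
    -- membership in the double difference is itself proved by a refutation.
    retained₁ : ∀ {X} → X ∈ elems (nm φ₁) → ¬ X ∉ elems 𝕁₁ → X ∈ elems (nm ψ₁)
    retained₁ p ¬q = nm-⊆ eq₁ (∈-∖⁺ (nm φ₁) (nm φ₁ ∖ 𝕁₁) p (¬q ∘ ∈-∖⇒∉ (nm φ₁) 𝕁₁))

    retained₂ : ∀ {X} → X ∈ elems (nm φ₂) → ¬ X ∉ elems 𝕁₂ → X ∈ elems (nm ψ₂)
    retained₂ p ¬q = nm-⊆ eq₂ (∈-∖⁺ (nm φ₂) (nm φ₂ ∖ 𝕁₂) p (¬q ∘ ∈-∖⇒∉ (nm φ₂) 𝕁₂))

    ψ₁⇒φ₁ : ∀ {X} → X ∈ elems (nm ψ₁) → X ∈ elems (nm φ₁) × X ∉ N₁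
    ψ₁⇒φ₁ p = ∖-⊆ (nm φ₁) (nm φ₁ ∖ 𝕁₁) (nm-⊇ eq₁ p) , ∈-∖⇒∉ (nm φ₁) (nm φ₁ ∖ 𝕁₁) (nm-⊇ eq₁ p)

    ψ₂⇒φ₂ : ∀ {X} → X ∈ elems (nm ψ₂) → X ∈ elems (nm φ₂) × X ∉ N₂
    ψ₂⇒φ₂ p = ∖-⊆ (nm φ₂) (nm φ₂ ∖ 𝕁₂) (nm-⊇ eq₂ p) , ∈-∖⇒∉ (nm φ₂) (nm φ₂ ∖ 𝕁₂) (nm-⊇ eq₂ p)

    ψ⊆φ : ∀ {X} → X ∈ elems (nm (ψ₁ ⊙ ψ₂)) → X ∈ elems (nm (φ₁ ⊙ φ₂))
    ψ⊆φ p = Sum.[ ⊆-∪ˡ (nm φ₁) (nm φ₂) ∘ proj₁ ∘ ψ₁⇒φ₁ , ⊆-∪ʳ (nm φ₁) (nm φ₂) ∘ proj₁ ∘ ψ₂⇒φ₂ ]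
      (∈-∪⁻ (nm ψ₁) (nm ψ₂) p)

    N₁-sep : ∀ {X} → X ∈ N₁ → X ∈ elems (nm φ₁) × X ∉ elems 𝕁 × X ∉ elems (nm φ₂)
    N₁-sep p = let q = ∖-⊆ (nm φ₁) 𝕁₁ p in q , sep₁ q (∈-∖⇒∉ (nm φ₁) 𝕁₁ p)

    N₂-sep : ∀ {X} → X ∈ N₂ → X ∈ elems (nm φ₂) × X ∉ elems 𝕁 × X ∉ elems (nm φ₁)
    N₂-sep p = let q = ∖-⊆ (nm φ₂) 𝕁₂ p in q , sep₂ q (∈-∖⇒∉ (nm φ₂) 𝕁₂ p)

    N#Z : Disjoint (N₂ ++ N₁) Z
    N#Z (p , q) with ∈-++⁻ N₂ p | ∈-∪⁻ (nm ψ₁) (nm ψ₂) (∖-⊆ (nm (ψ₁ ⊙ ψ₂)) 𝕁 q)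
    ... | inj₁ r | inj₁ s = proj₂ (proj₂ (N₂-sep r)) (proj₁ (ψ₁⇒φ₁ s))
    ... | inj₁ r | inj₂ s = proj₂ (ψ₂⇒φ₂ s) r
    ... | inj₂ r | inj₁ s = proj₂ (ψ₁⇒φ₁ s) r
    ... | inj₂ r | inj₂ s = proj₂ (proj₂ (N₁-sep r)) (proj₁ (ψ₂⇒φ₂ s))

    -- `N₂` precedes `N₁` so that, by `∑-++`, the sum over `N₂` is the innermost.
    partition : elems (nm (φ₁ ⊙ φ₂) ∖ 𝕁) ↭ (N₂ ++ N₁) ++ Z
    partition = unique-⊆-⊇⇒↭ (unique (nm (φ₁ ⊙ φ₂) ∖ 𝕁))
      (Unique.++⁺
        (Unique.++⁺ (unique (nm φ₂ ∖ 𝕁₂)) (unique (nm φ₁ ∖ 𝕁₁))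
          (λ { (p , q) → proj₂ (proj₂ (N₁-sep q)) (proj₁ (N₂-sep p)) }))
        (unique (nm (ψ₁ ⊙ ψ₂) ∖ 𝕁)) N#Z)
      to from
      where
      to : elems (nm (φ₁ ⊙ φ₂) ∖ 𝕁) ⊆ (N₂ ++ N₁) ++ Z
      to {X} p with ∈-∖⇒∉ (nm (φ₁ ⊙ φ₂)) 𝕁 p | ∈-∪⁻ (nm φ₁) (nm φ₂) (∖-⊆ (nm (φ₁ ⊙ φ₂)) 𝕁 p)
      ... | X∉𝕁 | inj₁ q with X ∈? elems 𝕁₁
      ...   | yes r = ∈-++⁺ʳ (N₂ ++ N₁) (∈-∖⁺ (nm (ψ₁ ⊙ ψ₂)) 𝕁
                        (⊆-∪ˡ (nm ψ₁) (nm ψ₂) (retained₁ q (λ r′ → r′ r))) X∉𝕁)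
      ...   | no  r = ∈-++⁺ˡ (∈-++⁺ʳ N₂ (∈-∖⁺ (nm φ₁) 𝕁₁ q r))
      to {X} p | X∉𝕁 | inj₂ q with X ∈? elems 𝕁₂
      ...   | yes r = ∈-++⁺ʳ (N₂ ++ N₁) (∈-∖⁺ (nm (ψ₁ ⊙ ψ₂)) 𝕁
                        (⊆-∪ʳ (nm ψ₁) (nm ψ₂) (retained₂ q (λ r′ → r′ r))) X∉𝕁)
      ...   | no  r = ∈-++⁺ˡ (∈-++⁺ˡ (∈-∖⁺ (nm φ₂) 𝕁₂ q r))

      from : (N₂ ++ N₁) ++ Z ⊆ elems (nm (φ₁ ⊙ φ₂) ∖ 𝕁)
      from p with ∈-++⁻ (N₂ ++ N₁) p
      ... | inj₂ q = ∈-∖⁺ (nm (φ₁ ⊙ φ₂)) 𝕁 (ψ⊆φ (∖-⊆ (nm (ψ₁ ⊙ ψ₂)) 𝕁 q)) (∈-∖⇒∉ (nm (ψ₁ ⊙ ψ₂)) 𝕁 q)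
      ... | inj₁ q with ∈-++⁻ N₂ q
      ...   | inj₁ r = let s , t , _ = N₂-sep r in
                       ∈-∖⁺ (nm (φ₁ ⊙ φ₂)) 𝕁 (⊆-∪ʳ (nm φ₁) (nm φ₂) s) t
      ...   | inj₂ r = let s , t , _ = N₁-sep r in
                       ∈-∖⁺ (nm (φ₁ ⊙ φ₂)) 𝕁 (⊆-∪ˡ (nm φ₁) (nm φ₂) s) t

    -- First `φ₁` leaves the sum over `N₂`, then the whole sum over `N₂` leaves the sum over `N₁`.
    -- The commutations are there because `∑-*ˡ` extracts left factors.
    factorise : ∀ σ → ∑ N₁ (∑ N₂ F) σ ≈ ev (ψ₁ ⊙ ψ₂) σ
    factorise σ = begin
      ∑ N₁ (∑ N₂ F) σ
        ≈⟨ ∑-cong N₁ (λ τ → ≈-trans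
             (∑-*ˡ N₂ (ev φ₁) (ev φ₂) (ev-local φ₁)
               (λ { (p , q) → proj₂ (proj₂ (N₂-sep q)) p }) τ)
             (*-comm _ _)) σ ⟩
      ∑ N₁ (λ τ → ∑ N₂ (ev φ₂) τ * ev φ₁ τ) σ
        ≈⟨ ∑-*ˡ N₁ (∑ N₂ (ev φ₂)) (ev φ₁) (∑-local N₂ (ev φ₂) (ev-local φ₂))
             (λ { (p , q) → proj₂ (proj₂ (N₁-sep q)) p }) σ ⟩
      ∑ N₂ (ev φ₂) σ * ∑ N₁ (ev φ₁) σ
        ≈⟨ *-comm _ _ ⟩
      ∑ N₁ (ev φ₁) σ * ∑ N₂ (ev φ₂) σ
        ≈⟨ *-cong (≈-trans (≈-sym (ev-sumOutside 𝕁₁ φ₁ σ)) (ev-≈ eq₁ σ))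
                  (≈-trans (≈-sym (ev-sumOutside 𝕁₂ φ₂ σ)) (ev-≈ eq₂ σ)) ⟩
      ev ψ₁ σ * ev ψ₂ σ
        ≈⟨ ev-⊙ ψ₁ ψ₂ σ ⟨
      ev (ψ₁ ⊙ ψ₂) σ ∎

-- Correctness of the decoration

unique-++⁻ : ∀ (Xs : List Name) {Ys} → Unique (Xs ++ Ys) → Unique Xs × Unique Ys × Disjoint Xs Ys
unique-++⁻ []       Ys!       = [] , Ys! , λ ()
unique-++⁻ (X ∷ Xs) (X∉ ∷ us) with unique-++⁻ Xs us
... | Xs! , Ys! , dis = All.++⁻ˡ Xs X∉ ∷ Xs! , Ys! , λ where
  (here refl , q) → All.lookup (All.++⁻ʳ Xs X∉) q refl
  (there p , q)   → dis (p , q)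

Occurs : ∀ {n} → Name → Ctx n → Ty → Set
Occurs Y Θ A = Y ∈ nmᶜ Θ Sum.⊎ Y ∈ nmᵗ A

∈-nmᴶ⁺ : ∀ {n} (Θ : Ctx n) A {Y} → Occurs Y Θ A → Y ∈ elems (nmᴶ Θ A)
∈-nmᴶ⁺ Θ A o = ∈-deduplicate⁺ _≟_ (Sum.[ ∈-++⁺ˡ , ∈-++⁺ʳ (nmᶜ Θ) ] o)

∈-nmᴶ⁻ : ∀ {n} (Θ : Ctx n) A {Y} → Y ∈ elems (nmᴶ Θ A) → Occurs Y Θ A
∈-nmᴶ⁻ Θ A p = ∈-++⁻ (nmᶜ Θ) (∈-deduplicate⁻ _≟_ (nmᶜ Θ ++ nmᵗ A) p)

infix 4 _∣_⊨[_]_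

_∣_⊨[_]_ : ∀ {n} → Name → Ctx n → Bool → Ty → Set
Y ∣ Θ ⊨[ τ ] A = Realizability._⊨[_]_ Y Θ τ A

⊎ᵖ-gnd : ∀ {P P₁ P₂ L} → P ≡ P₁ ⊎ᵖ P₂ → P ≡ gnd L → P₁ ≡ gnd L × P₂ ≡ gnd L
⊎ᵖ-gnd gnd refl = refl , refl

≅ᵖ-gnd : ∀ {P Q L} → P ≅ᵖ Q → Q ≡ gnd L → P ≡ gnd L
≅ᵖ-gnd gnd refl = refl

ground-∉ : ∀ {n} (Λ : Ctx n) {Y} → GroundCtx Λ →
           (∀ x {L} → lookup Λ x ≡ gnd L → Y ∉ nmᵍ L) → Y ∉ nmᶜ Λ
ground-∉ (P ∷ Λ) g h p with g zero | ∈-++⁻ (nmᵖ P) p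
... | gnd   | inj₁ q = h zero refl q
... | gnd   | inj₂ q = ground-∉ Λ (g ∘ suc) (h ∘ suc) q
... | empty | inj₂ q = ground-∉ Λ (g ∘ suc) (h ∘ suc) q

module Correctness {c ℓ : Level} (R : CommutativeSemiring c ℓ) where

  open Calculus R
  open FactorAlgebra R

  -- A value gets a ground type only through `i-var`, `i-pair` and `i-≅`, so no axiom occurs and all
  -- names are inherited from the context. This justifies the decoration `𝟏∅` of `i-pair` and the
  -- neglect of the value premise of `i-letp`.
  ground-value : ∀ {n} {Θ : Ctx n} {v L} (π : Θ ⊢ val v ∶ pos (gnd L)) →
                 cpts π ≡ [] × mainNames π ≡ [] × nmᵍ L ⊆ nmᶜ Θ
  ground-value {Θ = Θ} (i-var {x = x} e _) =
    refl , refl , λ p → ∈-nmᶜ⁺ Θ x (subst (λ P → _ ∈ nmᵖ P) (sym e) p)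
  ground-value (i-pair {L₁ = L₁} _ π₁ π₂) with ground-value π₁ | ground-value π₂
  ... | c₁ , m₁ , s₁ | c₂ , m₂ , s₂ =
    cong₂ _++_ c₁ c₂ , cong₂ _++_ m₁ m₂ , λ p → Sum.[ s₁ , s₂ ] (∈-++⁻ (nmᵍ L₁) p)
  ground-value (i-≅ {Θ = Θ} {Θ′} Θ≅Θ′ (pos gnd) π) with ground-value π
  ... | c , m , s = c , m , ∈-resp-↭ (≅ᶜ⇒nm↭ Θ Θ′ Θ≅Θ′) ∘ s

  nm-condFactor : ∀ {n k Y} {Λ : Ctx n} {ys} (Ys : Vec Name (ℕ.suc k)) X d →
    (∀ i → lookup Λ (lookup ys i) ≡ gnd (name (lookup Ys i))) →
    Y ∈ elems (nm (condFactor Ys X d)) → Occurs Y Λ (pos (gnd (name X)))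
  nm-condFactor {Λ = Λ} {ys} Ys X d h p with ∈-∪⁻ (fromList (Vec.toList Ys)) ⁅ X ⁆ p
  ... | inj₂ q = inj₂ q
  ... | inj₁ q with ∈-toList⁻ (∈-deduplicate⁻ _≟_ (Vec.toList Ys) q)
  ...   | r = inj₁ (∈-nmᶜ⁺ Λ (lookup ys (index r))
                (subst (λ P → _ ∈ nmᵖ P) (sym (h (index r))) (here (lookup-index r))))

  -- Soundness, tainting and freshness of derivations.

  module _ {Y : Name} where

    open Realizability Y

    mutual
      -- The condition on main names is used at the axioms: a conclusion `name Y` would have no
      -- realizer.
      sound : ∀ {n} {Θ : Ctx n} {t A} (π : Θ ⊢ t ∶ A) → Y ∉ mainNames π → Θ ⊨[ false ] A
      sound {Θ = Λ} (i-sample X g _) p m r = ⊩ᶜ-ground Λ g r , p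
      sound {Θ = Λ} (i-cond ys d Ys X g _ _) p m r = ⊩ᶜ-ground Λ g r , p
      sound {Θ = Θ} (i-var {x = x} refl g) p m r = ⊩ᶜ-lookup Θ x g r
      sound (i-let {Θ} {Θ₁} {Θ₂} {P = P} {A} s π₁ π₂) p =
        ⊨-let {Θ = Θ} {Θ₁} {Θ₂} {P} {A} false false s
          (sound π₁ (p ∘ ∈-++⁺ˡ)) (sound π₂ (p ∘ ∈-++⁺ʳ (mainNames π₁)))
      sound (i-pair {L₁ = L₁} g π₁ π₂) p m r
        with sound π₁ (p ∘ ∈-++⁺ˡ) m r | sound π₂ (p ∘ ∈-++⁺ʳ (mainNames π₁)) m r
      ... | e , q₁ | _ , q₂ = e , λ q → Sum.[ q₁ , q₂ ] (∈-++⁻ (nmᵍ L₁) q)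
      sound (i-letp {Θ} {L₁ = L₁} {L₂} {A} π₁ π₂) p =
        ⊨-letp {Θ = Θ} {L₁} {L₂} {A} false
          (sound π₁ (p ∘ ∈-++⁺ˡ)) (sound π₂ (p ∘ ∈-++⁺ʳ (mainNames π₁)))
      sound (i-abs {Θ} {P = P} {A} π) p = ⊨-abs {Θ = Θ} {P} {A} false (sound π p)
      sound (i-app {Θ} {Θ₁} {Θ₂} {P = P} {A} s π₁ π₂) p =
        ⊨-app {Θ = Θ} {Θ₁} {Θ₂} {P} {A} false false s
          (sound π₁ (p ∘ ∈-++⁺ˡ)) (sound π₂ (p ∘ ∈-++⁺ʳ (mainNames π₁)))
      sound (i-bang πs) p = sound! πs p
      sound (i-der {Θ} {A = A} π) p = ⊨-der {Θ = Θ} {A} false (sound π p)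
      sound (i-≅ {Θ} {Θ′} {A = A} {A′} Θ≅Θ′ A≅A′ π) p =
        ⊨-≅ {Θ = Θ} {Θ′} {A} {A′} false Θ≅Θ′ A≅A′ (sound π p)

      sound! : ∀ {n} {Θ : Ctx n} {t As} (πs : Θ ⊢! t ∶ As) → Y ∉ mainNames! πs →
               Θ ⊨[ false ] pos (bag As)
      sound! {Θ = Λ} (nil g) p m r = ⊩ᶜ-ground Λ g r
      sound! (cons {Θ} {Θ₁} {Θ₂} {A = A} {As} s π πs) p =
        ⊨-cons {Θ = Θ} {Θ₁} {Θ₂} {A} {As} false false s
          (sound π (p ∘ ∈-++⁺ˡ)) (sound! πs (p ∘ ∈-++⁺ʳ (mainNames π)))

    mutual
      -- The induction follows the axiom whose factor contains `Y`: the premise holding it taints,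
      -- the other one is merely sound. At the axiom itself `Y` is not the main name but occurs in
      -- the judgment, so `⊨-taint` applies.
      taints : ∀ {n} {Θ : Ctx n} {t A} (π : Θ ⊢ t ∶ A) → Y ∉ mainNames π →
               Any (λ φ → Y ∈ elems (nm φ)) (cpts π) → Θ ⊨[ true ] A
      taints (i-sample X _ _) p (here q) = contradiction q p
      taints {Θ = Λ} {A = A} π@(i-cond {Λ = Λ} ys d Ys X g h _) p (here q) =
        ⊨-taint Λ A (nm-condFactor {Λ = Λ} {ys} Ys X d h q) (sound π p)
      taints (i-let {Θ} {Θ₁} {Θ₂} {P = P} {A} s π₁ π₂) p q with Any.++⁻ (cpts π₁) q
      ... | inj₁ r = ⊨-let {Θ = Θ} {Θ₁} {Θ₂} {P} {A} true false s
        (taints π₁ (p ∘ ∈-++⁺ˡ) r) (sound π₂ (p ∘ ∈-++⁺ʳ (mainNames π₁)))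
      ... | inj₂ r = ⊨-let {Θ = Θ} {Θ₁} {Θ₂} {P} {A} false true s
        (sound π₁ (p ∘ ∈-++⁺ˡ)) (taints π₂ (p ∘ ∈-++⁺ʳ (mainNames π₁)) r)
      taints π@(i-pair _ _ _) p q with () ← subst (Any _) (proj₁ (ground-value π)) q
      taints (i-letp {Θ} {L₁ = L₁} {L₂} {A} π₁ π₂) p q with Any.++⁻ (cpts π₁) q
      ... | inj₁ r with () ← subst (Any _) (proj₁ (ground-value π₁)) r
      ... | inj₂ r = ⊨-letp {Θ = Θ} {L₁} {L₂} {A} true
        (sound π₁ (p ∘ ∈-++⁺ˡ)) (taints π₂ (p ∘ ∈-++⁺ʳ (mainNames π₁)) r)
      taints (i-abs {Θ} {P = P} {A} π) p q = ⊨-abs {Θ = Θ} {P} {A} true (taints π p q)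
      taints (i-app {Θ} {Θ₁} {Θ₂} {P = P} {A} s π₁ π₂) p q with Any.++⁻ (cpts π₁) q
      ... | inj₁ r = ⊨-app {Θ = Θ} {Θ₁} {Θ₂} {P} {A} true false s
        (taints π₁ (p ∘ ∈-++⁺ˡ) r) (sound π₂ (p ∘ ∈-++⁺ʳ (mainNames π₁)))
      ... | inj₂ r = ⊨-app {Θ = Θ} {Θ₁} {Θ₂} {P} {A} false true s
        (sound π₁ (p ∘ ∈-++⁺ˡ)) (taints π₂ (p ∘ ∈-++⁺ʳ (mainNames π₁)) r)
      taints (i-bang πs) p q = taints! πs p q
      taints (i-der {Θ} {A = A} π) p q = ⊨-der {Θ = Θ} {A} true (taints π p q)
      taints (i-≅ {Θ} {Θ′} {A = A} {A′} Θ≅Θ′ A≅A′ π) p q =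
        ⊨-≅ {Θ = Θ} {Θ′} {A} {A′} true Θ≅Θ′ A≅A′ (taints π p q)

      taints! : ∀ {n} {Θ : Ctx n} {t As} (πs : Θ ⊢! t ∶ As) → Y ∉ mainNames! πs →
                Any (λ φ → Y ∈ elems (nm φ)) (cpts! πs) → Θ ⊨[ true ] pos (bag As)
      taints! (cons {Θ} {Θ₁} {Θ₂} {A = A} {As} s π πs) p q with Any.++⁻ (cpts π) q
      ... | inj₁ r = ⊨-cons {Θ = Θ} {Θ₁} {Θ₂} {A} {As} true false s
        (taints π (p ∘ ∈-++⁺ˡ) r) (sound! πs (p ∘ ∈-++⁺ʳ (mainNames π)))
      ... | inj₂ r = ⊨-cons {Θ = Θ} {Θ₁} {Θ₂} {A} {As} false true s
        (sound π (p ∘ ∈-++⁺ˡ)) (taints! πs (p ∘ ∈-++⁺ʳ (mainNames π)) r)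

    mutual
      -- Ground entries reach the premises unchanged, so the side condition of an axiom propagates
      -- down to the root. The value premise of `i-letp` has no main names.
      mainNames-fresh : ∀ {n} {Θ : Ctx n} {t A} (π : Θ ⊢ t ∶ A) → Y ∈ mainNames π →
                        ∀ x {L} → lookup Θ x ≡ gnd L → Y ∉ nmᵍ L
      mainNames-fresh {Θ = Λ} (i-sample X _ X∉) (here refl) x e q =
        X∉ (∈-nmᶜ⁺ Λ x (subst (λ P → _ ∈ nmᵖ P) (sym e) q))
      mainNames-fresh {Θ = Λ} (i-cond _ _ _ X _ _ X∉) (here refl) x e q =
        X∉ (∈-nmᶜ⁺ Λ x (subst (λ P → _ ∈ nmᵖ P) (sym e) q))
      mainNames-fresh (i-let s π₁ π₂) p x e with ∈-++⁻ (mainNames π₁) p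
      ... | inj₁ q = mainNames-fresh π₁ q x (proj₁ (⊎ᵖ-gnd (s x) e))
      ... | inj₂ q = mainNames-fresh π₂ q (suc x) (proj₂ (⊎ᵖ-gnd (s x) e))
      mainNames-fresh (i-pair _ π₁ π₂) p x e with ∈-++⁻ (mainNames π₁) p
      ... | inj₁ q = mainNames-fresh π₁ q x e
      ... | inj₂ q = mainNames-fresh π₂ q x e
      mainNames-fresh (i-letp π₁ π₂) p x e with ∈-++⁻ (mainNames π₁) p
      ... | inj₁ q with () ← subst (Y ∈_) (proj₁ (proj₂ (ground-value π₁))) q
      ... | inj₂ q = mainNames-fresh π₂ q (suc (suc x)) e
      mainNames-fresh (i-abs π) p x e = mainNames-fresh π p (suc x) e
      mainNames-fresh (i-app s π₁ π₂) p x e with ∈-++⁻ (mainNames π₁) p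
      ... | inj₁ q = mainNames-fresh π₁ q x (proj₁ (⊎ᵖ-gnd (s x) e))
      ... | inj₂ q = mainNames-fresh π₂ q x (proj₂ (⊎ᵖ-gnd (s x) e))
      mainNames-fresh (i-bang πs) p x e = mainNames!-fresh πs p x e
      mainNames-fresh (i-der π) p x e = mainNames-fresh π p x e
      mainNames-fresh (i-≅ Θ≅Θ′ _ π) p x e = mainNames-fresh π p x (≅ᵖ-gnd (Θ≅Θ′ x) e)

      mainNames!-fresh : ∀ {n} {Θ : Ctx n} {t As} (πs : Θ ⊢! t ∶ As) → Y ∈ mainNames! πs →
                         ∀ x {L} → lookup Θ x ≡ gnd L → Y ∉ nmᵍ L
      mainNames!-fresh (cons s π πs) p x e with ∈-++⁻ (mainNames π) p
      ... | inj₁ q = mainNames-fresh π q x (proj₁ (⊎ᵖ-gnd (s x) e))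
      ... | inj₂ q = mainNames!-fresh πs q x (proj₂ (⊎ᵖ-gnd (s x) e))

  -- Collects what the binary step needs from a derivation, so that single derivations and the
  -- premise families of `i-bang` are handled alike.
  record Premise {n} (Θ : Ctx n) (A : Ty) : Set (c ⊔ ℓ) where
    field
      mains     : List Name
      axioms    : List Factor
      soundness : ∀ Y → Y ∉ mains → Y ∣ Θ ⊨[ false ] A
      tainting  : ∀ Y → Y ∉ mains → Any (λ φ → Y ∈ elems (nm φ)) axioms → Y ∣ Θ ⊨[ true ] A

  open Premise

  premise : ∀ {n} {Θ : Ctx n} {t A} → Θ ⊢ t ∶ A → Premise Θ A
  premise π = record
    { mains = mainNames π ; axioms = cpts π
    ; soundness = λ _ → sound π ; tainting = λ _ → taints π }

  premise! : ∀ {n} {Θ : Ctx n} {t As} → Θ ⊢! t ∶ As → Premise Θ (pos (bag As))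
  premise! πs = record
    { mains = mainNames! πs ; axioms = cpts! πs
    ; soundness = λ _ → sound! πs ; tainting = λ _ → taints! πs }

  -- The invariant carried from the ground root down to the subderivations.
  Untainted : ∀ {n} → List Name → Ctx n → Ty → Set
  Untainted Xs Θ A = ∀ Y → Y ∈ Xs → ¬ Y ∣ Θ ⊨[ true ] A

  Correct : ∀ {n} {Θ : Ctx n} {A} → Premise Θ A → Factor → Set ℓ
  Correct {Θ = Θ} {A} p ψ = Unique (mains p) → Untainted (mains p) Θ A →
    sumOutside (nmᴶ Θ A) (⨀ (axioms p)) ≃ ψ

  -- If `X` were not a main name of `p₁`, using it would taint a judgment that does not mention it.
  -- So `X` is a main name of `p₁` and not of `p₂`. An occurrence of `X` in the conclusion would
  -- have to come from the second judgment; there, or in the factors of `p₂`, it would make `p₂`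
  -- taint and break the invariant.
  separated : ∀ {n₁ n₂ n} {Θ₁ : Ctx n₁} {Θ₂ : Ctx n₂} (Θ : Ctx n) {A₁ A₂} A
    (p₁ : Premise Θ₁ A₁) (p₂ : Premise Θ₂ A₂) →
    (∀ Y → Y ∣ Θ₁ ⊨[ false ] A₁ → Y ∣ Θ₂ ⊨[ true ] A₂ → Y ∣ Θ ⊨[ true ] A) →
    (∀ {Y} → Occurs Y Θ A → Occurs Y Θ₁ A₁ Sum.⊎ Occurs Y Θ₂ A₂) →
    Disjoint (mains p₁) (mains p₂) → Untainted (mains p₁) Θ A →
    ∀ {X} → X ∈ elems (nm (⨀ (axioms p₁))) → X ∉ elems (nmᴶ Θ₁ A₁) →
    X ∉ elems (nmᴶ Θ A) × X ∉ elems (nm (⨀ (axioms p₂)))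
  separated {Θ₁ = Θ₁} {Θ₂} Θ {A₁} {A₂} A p₁ p₂ rule occurs dis untainted {X} X∈ X∉
    with X ∈? mains p₁
  ... | no  X∉₁ = contradiction (tainting p₁ X X∉₁ (∈-⨀⁻ (axioms p₁) X∈))
                    (Realizability.⊭-free X Θ₁ A₁ (X∉J₁ ∘ inj₁) (X∉J₁ ∘ inj₂))
    where
    X∉J₁ : ¬ Occurs X Θ₁ A₁
    X∉J₁ = X∉ ∘ ∈-nmᴶ⁺ Θ₁ A₁
  ... | yes X∈₁ =
    (λ q → Sum.[ X∉J₁ , (λ o → absurd (Realizability.⊨-taint X Θ₂ A₂ o (soundness p₂ X X∉₂))) ]
             (occurs (∈-nmᴶ⁻ Θ A q))) ,
    (λ q → absurd (tainting p₂ X X∉₂ (∈-⨀⁻ (axioms p₂) q)))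
    where
    X∉J₁ : ¬ Occurs X Θ₁ A₁
    X∉J₁ = X∉ ∘ ∈-nmᴶ⁺ Θ₁ A₁

    X∉₂ : X ∉ mains p₂
    X∉₂ q = dis (X∈₁ , q)

    absurd : ¬ X ∣ Θ₂ ⊨[ true ] A₂
    absurd = untainted X X∈₁ ∘
      rule X (Realizability.⊨-free X Θ₁ A₁ (X∉J₁ ∘ inj₁) (X∉J₁ ∘ inj₂))

  -- Common core of `i-let`, `i-app` and each step of `i-bang`. The two name inclusions are returned
  -- for `i-bang`, where the remaining outer sum has to be shown empty.
  correct-⊙ : ∀ {n₁ n₂ n} {Θ₁ : Ctx n₁} {Θ₂ : Ctx n₂} (Θ : Ctx n) {A₁ A₂} A {ψ₁ ψ₂}
    (p₁ : Premise Θ₁ A₁) (p₂ : Premise Θ₂ A₂) →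
    (∀ Y τ σ → Y ∣ Θ₁ ⊨[ τ ] A₁ → Y ∣ Θ₂ ⊨[ σ ] A₂ → Y ∣ Θ ⊨[ τ ∨ σ ] A) →
    (∀ {Y} → Occurs Y Θ A → Occurs Y Θ₁ A₁ Sum.⊎ Occurs Y Θ₂ A₂) →
    Correct p₁ ψ₁ → Correct p₂ ψ₂ →
    Unique (mains p₁ ++ mains p₂) → Untainted (mains p₁ ++ mains p₂) Θ A →
    elems (nm ψ₁) ⊆ elems (nmᴶ Θ₁ A₁) × elems (nm ψ₂) ⊆ elems (nmᴶ Θ₂ A₂) ×
    sumOutside (nmᴶ Θ A) (⨀ (axioms p₁ ++ axioms p₂)) ≃ sumOutside (nmᴶ Θ A) (ψ₁ ⊙ ψ₂)
  correct-⊙ {Θ₁ = Θ₁} {Θ₂} Θ {A₁} {A₂} A {ψ₁} {ψ₂} p₁ p₂ rule occurs ih₁ ih₂ uniq untainted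
    with unique-++⁻ (mains p₁) uniq
  ... | uniq₁ , uniq₂ , dis =
    ∖∖-⊆ (nm φ₁) (nmᴶ Θ₁ A₁) ∘ _≃_.nm-⊇ eq₁ ,
    ∖∖-⊆ (nm φ₂) (nmᴶ Θ₂ A₂) ∘ _≃_.nm-⊇ eq₂ ,
    ≃-trans
      (sumOutside-cong (nmᴶ Θ A) (nmᴶ Θ A) (⨀-++ (axioms p₁) (axioms p₂)) (λ _ q → q) (λ _ q → q))
      (sumOutside-⊙ (nmᴶ Θ₁ A₁) (nmᴶ Θ₂ A₂) (nmᴶ Θ A) {φ₁} {φ₂} eq₁ eq₂
        (separated Θ A p₁ p₂ (λ Y → rule Y false true) occurs dis
          (λ Y q → untainted Y (∈-++⁺ˡ q)))
        (separated Θ A p₂ p₁ (λ Y f g → rule Y true false g f) (Sum.swap ∘ occurs)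
          (λ { (q , r) → dis (r , q) }) (λ Y q → untainted Y (∈-++⁺ʳ (mains p₁) q))))
    where
    φ₁ φ₂ : Factor
    φ₁ = ⨀ (axioms p₁)
    φ₂ = ⨀ (axioms p₂)

    eq₁ : sumOutside (nmᴶ Θ₁ A₁) φ₁ ≃ ψ₁
    -- The invariant descends: a main name of `p₁` is not one of `p₂`, so `p₂` is sound for it and a
    -- taint of the first judgment would reach the conclusion.
    eq₁ = ih₁ uniq₁ λ Y q f → untainted Y (∈-++⁺ˡ q)
      (rule Y true false f (soundness p₂ Y λ r → dis (q , r)))

    eq₂ : sumOutside (nmᴶ Θ₂ A₂) φ₂ ≃ ψ₂
    eq₂ = ih₂ uniq₂ λ Y q f → untainted Y (∈-++⁺ʳ (mains p₁) q)
      (rule Y false true (soundness p₁ Y λ r → dis (r , q)) f)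

  sumOutside-[-] : ∀ 𝕁 φ → elems (nm φ) ⊆ elems 𝕁 → sumOutside 𝕁 (⨀ (φ ∷ [])) ≃ φ
  sumOutside-[-] 𝕁 φ φ⊆𝕁 = ≃-trans
    (sumOutside-cong 𝕁 𝕁 (⨀-[-] φ) (λ _ q → q) (λ _ q → q)) (sumOutside-⊇ 𝕁 φ φ⊆𝕁)

  -- For rules that transmit the factor of one premise: the premise and the conclusion mention the
  -- same names, so the same names are summed out.
  sumOutside-nmᴶ : ∀ {n n′} (Θ : Ctx n) A (Θ′ : Ctx n′) A′ φ {ψ} →
    (∀ {Y} → Occurs Y Θ A → Occurs Y Θ′ A′) → (∀ {Y} → Occurs Y Θ′ A′ → Occurs Y Θ A) →
    sumOutside (nmᴶ Θ′ A′) φ ≃ ψ → sumOutside (nmᴶ Θ A) φ ≃ ψ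
  sumOutside-nmᴶ Θ A Θ′ A′ φ to from = ≃-trans
    (sumOutside-cong (nmᴶ Θ A) (nmᴶ Θ′ A′) (≃-refl {φ})
      (λ _ → ∈-nmᴶ⁺ Θ′ A′ ∘ to ∘ ∈-nmᴶ⁻ Θ A) (λ _ → ∈-nmᴶ⁺ Θ A ∘ from ∘ ∈-nmᴶ⁻ Θ′ A′))

  mutual
    correct : ∀ {n} {Θ : Ctx n} {t A} (π : Θ ⊢ t ∶ A) → Correct (premise π) (decorate π)
    correct {Θ = Λ} {A = A} (i-sample {d = d} X _ _) _ _ =
      sumOutside-[-] (nmᴶ Λ A) (sampleFactor X d) (∈-nmᴶ⁺ Λ A ∘ inj₂)
    correct {Θ = Λ} {A = A} (i-cond ys d Ys X _ h _) _ _ =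
      sumOutside-[-] (nmᴶ Λ A) (condFactor Ys X d)
        (∈-nmᴶ⁺ Λ A ∘ nm-condFactor {Λ = Λ} {ys} Ys X d h)
    correct {Θ = Θ} {A = A} (i-var _ _) _ _ = sumOutside-⊇ (nmᴶ Θ A) 𝟏∅ λ ()
    correct (i-let {Θ} {Θ₁} {Θ₂} {P = P} {A} s π₁ π₂) uniq untainted =
      proj₂ (proj₂ (correct-⊙ Θ A (premise π₁) (premise π₂)
        (λ Y τ σ → Realizability.⊨-let Y {Θ = Θ} {Θ₁} {Θ₂} {P} {A} τ σ s)
        (λ where
          (inj₁ p) → Sum.map inj₁ (inj₁ ∘ ∈-++⁺ʳ (nmᵖ P)) (∈-⊎⁻ Θ Θ₁ Θ₂ s p)
          (inj₂ p) → inj₂ (inj₂ p))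
        (correct π₁) (correct π₂) uniq untainted))
    correct {Θ = Θ} {A = A} π@(i-pair _ _ _) _ _ =
      subst (λ φs → sumOutside (nmᴶ Θ A) (⨀ φs) ≃ 𝟏∅) (sym (proj₁ (ground-value π)))
        (sumOutside-⊇ (nmᴶ Θ A) 𝟏∅ λ ())
    correct (i-letp {Θ} {L₁ = L₁} {L₂} {A} π₁ π₂) uniq untainted
      with ground-value π₁ | unique-++⁻ (mainNames π₁) uniq
    ... | no-axioms , no-mains , L⊆Θ | _ , uniq₂ , _ =
      subst (λ φs → sumOutside (nmᴶ Θ A) (⨀ (φs ++ cpts π₂)) ≃ decorate π₂) (sym no-axioms)
        (sumOutside-nmᴶ Θ A Θ′ A (⨀ (cpts π₂)) to from (correct π₂ uniq₂ λ Y p f →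
          untainted Y (∈-++⁺ʳ (mainNames π₁) p)
            (Realizability.⊨-letp Y {Θ = Θ} {L₁} {L₂} {A} true
              (sound π₁ (λ q → contradiction (subst (Y ∈_) no-mains q) λ ())) f)))
      where
      Θ′ : Ctx _
      Θ′ = gnd L₂ ∷ gnd L₁ ∷ Θ

      to : ∀ {Y} → Occurs Y Θ A → Occurs Y Θ′ A
      to = Sum.map₁ (∈-++⁺ʳ (nmᵍ L₂) ∘ ∈-++⁺ʳ (nmᵍ L₁))

      -- The names of the bound variables are names of the value's type, which `ground-value` traces
      -- back to the context.
      from : ∀ {Y} → Occurs Y Θ′ A → Occurs Y Θ A
      from (inj₂ p) = inj₂ p
      from (inj₁ p) with ∈-++⁻ (nmᵍ L₂) p
      ... | inj₁ q = inj₁ (groundPart-nm⊆ Θ (L⊆Θ (∈-++⁺ʳ (nmᵍ L₁) q)))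
      ... | inj₂ q with ∈-++⁻ (nmᵍ L₁) q
      ...   | inj₁ r = inj₁ (groundPart-nm⊆ Θ (L⊆Θ (∈-++⁺ˡ r)))
      ...   | inj₂ r = inj₁ r
    correct (i-abs {Θ} {P = P} {A} π) uniq untainted =
      sumOutside-nmᴶ Θ (P ⊸ A) (P ∷ Θ) A (⨀ (cpts π))
        (λ where
          (inj₁ p) → inj₁ (∈-++⁺ʳ (nmᵖ P) p)
          (inj₂ p) → Sum.map₁ ∈-++⁺ˡ (∈-++⁻ (nmᵖ P) p))
        (λ where
          (inj₁ p) → Sum.swap (Sum.map₁ ∈-++⁺ˡ (∈-++⁻ (nmᵖ P) p))
          (inj₂ p) → inj₂ (∈-++⁺ʳ (nmᵖ P) p))
        (correct π uniq λ Y p f →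
          untainted Y p (Realizability.⊨-abs Y {Θ = Θ} {P} {A} true f))
    correct (i-app {Θ} {Θ₁} {Θ₂} {P = P} {A} s π₁ π₂) uniq untainted =
      proj₂ (proj₂ (correct-⊙ Θ A (premise π₁) (premise π₂)
        (λ Y τ σ → Realizability.⊨-app Y {Θ = Θ} {Θ₁} {Θ₂} {P} {A} τ σ s)
        (λ where
          (inj₁ p) → Sum.map inj₁ inj₁ (∈-⊎⁻ Θ Θ₁ Θ₂ s p)
          (inj₂ p) → inj₁ (inj₂ (∈-++⁺ʳ (nmᵖ P) p)))
        (correct π₁) (correct π₂) uniq untainted))
    correct (i-bang πs) uniq untainted = correct! πs uniq untainted
    correct (i-der {Θ} {A = A} π) uniq untainted =
      sumOutside-nmᴶ Θ A Θ (pos (bag (A ∷ []))) (⨀ (cpts π))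
        (Sum.map₂ ∈-++⁺ˡ)
        (Sum.map₂ (λ p → Sum.[ id , (λ ()) ] (∈-++⁻ (nmᵗ A) p)))
        (correct π uniq λ Y p f → untainted Y p (Realizability.⊨-der Y {Θ = Θ} {A} true f))
    correct (i-≅ {Θ} {Θ′} {A = A} {A′} Θ≅Θ′ A≅A′ π) uniq untainted =
      sumOutside-nmᴶ Θ′ A′ Θ A (⨀ (cpts π))
        (Sum.map (∈-resp-↭ (↭-sym Θ↭Θ′)) (∈-resp-↭ (↭-sym A↭A′)))
        (Sum.map (∈-resp-↭ Θ↭Θ′) (∈-resp-↭ A↭A′))
        (correct π uniq λ Y p f →
          untainted Y p (Realizability.⊨-≅ Y {Θ = Θ} {Θ′} {A} {A′} true Θ≅Θ′ A≅A′ f))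
      where
      Θ↭Θ′ = ≅ᶜ⇒nm↭ Θ Θ′ Θ≅Θ′
      A↭A′ = ≅⇒nm↭ A≅A′

    -- The decoration of `i-bang` sums nothing out, whereas `correct-⊙` ends in a sum. That sum is
    -- empty, since the conclusion retains every name of the premises' contexts and types.
    correct! : ∀ {n} {Θ : Ctx n} {t As} (πs : Θ ⊢! t ∶ As) →
               Correct (premise! πs) (⨀ (decorate! πs))
    correct! {Θ = Λ} (nil _) _ _ = sumOutside-⊇ (nmᴶ Λ (pos (bag []))) 𝟏∅ λ ()
    correct! (cons {Θ} {Θ₁} {Θ₂} {A = A} {As} s π πs) uniq untainted
      with correct-⊙ Θ (pos (bag (A ∷ As))) (premise π) (premise! πs)
        (λ Y τ σ → Realizability.⊨-cons Y {Θ = Θ} {Θ₁} {Θ₂} {A} {As} τ σ s)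
        (λ where
          (inj₁ p) → Sum.map inj₁ inj₁ (∈-⊎⁻ Θ Θ₁ Θ₂ s p)
          (inj₂ p) → Sum.map inj₂ inj₂ (∈-++⁻ (nmᵗ A) p))
        (correct π) (correct! πs) uniq untainted
    ... | ψ₁⊆J₁ , ψ₂⊆J₂ , eq = ≃-trans eq
      (sumOutside-⊇ (nmᴶ Θ B) (decorate π ⊙ ⨀ (decorate! πs)) λ p →
        ∈-nmᴶ⁺ Θ B (Sum.[ Sum.map (∈-⊎⁺ Θ Θ₁ Θ₂ s ∘ inj₁) ∈-++⁺ˡ ∘ ∈-nmᴶ⁻ Θ₁ A ∘ ψ₁⊆J₁
                        , Sum.map (∈-⊎⁺ Θ Θ₁ Θ₂ s ∘ inj₂) (∈-++⁺ʳ (nmᵗ A))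
                            ∘ ∈-nmᴶ⁻ Θ₂ (pos (bag As)) ∘ ψ₂⊆J₂ ]
                        (∈-∪⁻ (nm (decorate π)) (nm (⨀ (decorate! πs))) p)))
      where
      B : Ty
      B = pos (bag (A ∷ As))

  -- Main names are fresh for the ground context, which therefore has the clean realizer; a tainting
  -- judgment would turn it into a tainted realizer of `L`, and a ground type has none.
  untainted-ground : ∀ {n} {Λ : Ctx n} {t L} → GroundCtx Λ → (π : Λ ⊢ t ∶ pos (gnd L)) →
                     Untainted (mainNames π) Λ (pos (gnd L))
  untainted-ground {Λ = Λ} g π Y p f
    with () ← proj₁ (f false (Realizability.false-⊩ᶜ Y Λ (ground-∉ Λ g (mainNames-fresh π p))))

theorem6p9 : {c ℓ : Level} (R : CommutativeSemiring c ℓ) → let open Calculus R in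
    (n : ℕ) (Λ : Ctx n) → GroundCtx Λ →
    (t : Term n) (L : Ground) (π : Derivation Λ t (pos (gnd L))) →
    ⟦ π ⟧ ≋ decorate (tree π)
theorem6p9 R n Λ g t L π =
  ≃⇒≋ (correct (tree π) (naming π) (untainted-ground g (tree π)))
  where
  open Calculus R
  open FactorAlgebra R
  open Correctness R
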